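{- Let $\mathbb{F}_q$ be a finite field with $q$ elements. Let $M$ be a square multislant matrix (over $\mathbb{F}_q$) that is not the $0 \times 0$-matrix. Let $(i,j,\ell)$ be the signature of $M$, and let $k = i+j+\ell$ be the number of blocks of $M$. Then $$\operatorname{SiPr} M = 1-\gamma_{k}\left(1-\frac{0^{\ell}}{q^{i}}\right),$$ where $0^\ell = 0$ if $\ell > 0$ and $0^\ell = 1$ if $\ell = 0$.
   Context: All matrices have entries in $\mathbb{F}_q$ or in a polynomial ring over $\mathbb{F}_q$. Slant matrix: a $u \times v$-matrix $A = (a_{r,c})$ with $u \geq v \geq 1$ is a slant matrix if, with $m := u - v \geq 0$: (1) $A$ is Toeplitz, i.e., $a_{r,c}$ depends only on $r-c$; (2) all entries $a_{r,c}$ with $r - c > m$ ("basement entries") are $0$; (3) there are $u_0, u_1, \ldots, u_m$ such that $a_{r,c} = u_{m-d}$ whenever $r - c = d$ with $0 \leq d \leq m$, where $u_1, \ldots, u_m$ are distinct indeterminates, and $u_0$ is either an indeterminate distinct from $u_1, \ldots, u_m$ or an element of $\mathbb{F}_q$; (4) each entry $a_{r,c}$ with $r < c$ ("attic entry") is an indeterminate or an element of $\mathbb{F}_q$; (5) no indeterminate among the attic entries equals any of the indeterminates among $u_0, \ldots, u_m$. (Indeterminates on different attic diagonals may coincide.) Types: $A$ has type X if $u_0$ is an indeterminate, type 0 if $u_0 = 0$, and type 1 if $u_0 \in \mathbb{F}_q \setminus \{0\}$. Two slant matrices are disjoint if no indeterminate appears in both. Multislant matrix: a block matrix $M = (A_1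 \mid A_2 \mid \cdots \mid A_k)$ (blocks arranged horizontally from left to right), where $A_1, \ldots, A_k$ are pairwise disjoint slant matrices with the same number of rows; these are called the blocks of $M$. The signature of $M$ is $(i,j,\ell)$, where $i$, $j$, $\ell$ are the numbers of blocks of type X, type 0, type 1, respectively. Singular probability: for a square multislant matrix $M$, $\operatorname{SiPr} M$ is the probability that $\det M$ becomes $0$ when uniformly and independently random elements of $\mathbb{F}_q$ are substituted for the (distinct) indeterminates appearing in $M$. For each positive integer $k$, $\gamma_k := \prod_{s=1}^{k-1}\left(1 - \frac{1}{q^s}\right)$ (so $\gamma_1 = 1$); also $\gamma_0 := 1$. -}

module Defs where

open import Algebra.Structures using (IsCommutativeRing)
open import Algebra.Bundles using (CommutativeRing; module Semiring)
open import Algebra.Core using (Op₁; Op₂)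
import Algebra.Definitions.RawMonoid as RawMonoidDefs
import Algebra.Definitions.RawSemiring as RawSemiringDefs
open import Data.Bool.Base using (if_then_else_)
open import Data.Fin.Base as Fin using (Fin; toℕ; cast)
open import Data.Fin.Properties using (inj⇒≟; nonZeroIndex)
open import Data.Integer.Base using (+_)
open import Data.List.Base as List using (List; []; _∷_; allFin; cartesianProductWith; deduplicate; filter; length; mapMaybe)
open import Data.List.Relation.Unary.AllPairs using (AllPairs)
open import Data.Maybe.Base using (Maybe; just; nothing)
open import Data.Nat.Base as ℕ using (ℕ; zero; suc; NonZero; _≤_; _<_; _∸_; _^_)
import Data.Nat.ListAction as ListAction
open import Data.Nat.Properties as ℕₚ using (m^n≢0)
open import Data.Product.Base using (∃; ∃₂; _×_; _,_)
open import Data.Rational.Base as ℚ using (ℚ; 1ℚ; _/_)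
open import Data.Vec.Functional as Vector using (Vector; removeAt)
open import Function.Base using (_∘_)
open import Function.Bundles using (_↔_; module Inverse)
open import Function.Definitions using (Injective)
open import Function.Properties.Inverse using (↔⇒↣; ↔-sym)
open import Level using (Level)
open import Relation.Binary.Definitions using (DecidableEquality)
open import Relation.Binary.PropositionalEquality using (_≡_; _≢_; sym)
open import Relation.Nullary using (¬_; does)

record FiniteField (c : Level) : Set (Level.suc c) where
  infixl 6 _+_
  infixl 7 _*_
  infix  8 -_
  field
    Carrier           : Set c
    _+_ _*_           : Op₂ Carrier
    -_                : Op₁ Carrier
    0# 1#             : Carrier
    isCommutativeRing : IsCommutativeRing _≡_ _+_ _*_ -_ 0# 1#
    0≢1               : 0# ≢ 1#
    inverse           : ∀ x → x ≢ 0# → ∃ λ y → x * y ≡ 1#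
    q                 : ℕ
    enumeration       : Fin q ↔ Carrier

  commutativeRing : CommutativeRing c c
  commutativeRing = record { isCommutativeRing = isCommutativeRing }

  open Inverse enumeration using () renaming (to to element; from to index)

  elements : List Carrier
  elements = List.map element (allFin q)

  _≟_ : DecidableEquality Carrier
  _≟_ = inj⇒≟ (↔⇒↣ (↔-sym enumeration))

  instance
    q-nonZero : NonZero q
    q-nonZero = nonZeroIndex (index 0#)

  infix 7 _/q^_
  _/q^_ : ℕ → ℕ → ℚ
  a /q^ n = _/_ (+ a) (q ^ n) {{m^n≢0 q n}}

Matrix : ∀ {a} → Set a → ℕ → ℕ → Set a
Matrix A u v = Vector (Vector A v) u

-- Indeterminates of the polynomial ring are named by natural numbers.
Indet : Set
Indet = ℕ

data BlockType : Set where
  typeX type0 type1 : BlockType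

tally : List BlockType → ℕ × ℕ × ℕ
tally []           = 0 , 0 , 0
tally (typeX ∷ ts) = let i , j , ℓ = tally ts in suc i , j , ℓ
tally (type0 ∷ ts) = let i , j , ℓ = tally ts in i , suc j , ℓ
tally (type1 ∷ ts) = let i , j , ℓ = tally ts in i , j , suc ℓ

module OverField {c} (F : FiniteField c) where

  open FiniteField F hiding (_/q^_)
  open FiniteField F public using (_/q^_)
  open CommutativeRing commutativeRing using (+-rawMonoid; semiring)
  open RawMonoidDefs +-rawMonoid using (sum)
  open RawSemiringDefs (Semiring.rawSemiring semiring) using () renaming (_^_ to _^F_)

  -- Cofactor expansion along the first row.
  det : ∀ {n} → Matrix Carrier n n → Carrier
  det {zero}  A = 1#
  det {suc n} A = sum λ k →
    (- 1#) ^F toℕ k * (A Fin.zero k * det λ r → removeAt (A (Fin.suc r)) k)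

  -- The elements of the polynomial ring that may occur as entries of a slant
  -- matrix: single indeterminates and constants.
  data Entry : Set c where
    indet : Indet   → Entry
    const : Carrier → Entry

  _OccursIn_ : ∀ {u v} → Indet → Matrix Entry u v → Set c
  x OccursIn A = ∃₂ λ r k → A r k ≡ indet x

  Disjoint : ∀ {u v w} → Matrix Entry u v → Matrix Entry u w → Set c
  Disjoint A B = ∀ x → ¬ (x OccursIn A × x OccursIn B)

  -- Differences r - k of indices are compared by moving the subtrahends to the
  -- other side.  The entry diag s is u_s, for 0 ≤ s ≤ m; it lies on the
  -- diagonal r - k = m - s.  A constant u_0 is automatically distinct from the
  -- indeterminates u_1, …, u_m, so the distinctness condition in both of the
  -- cases for u_0 amounts to injectivity of diag.
  record IsSlant {u v} (A : Matrix Entry u v) : Set c where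
    m : ℕ
    m = u ∸ v
    field
      v≥1            : 1 ≤ v
      u≥v            : v ≤ u
      toeplitz       : ∀ r k r′ k′ → toℕ r ℕ.+ toℕ k′ ≡ toℕ r′ ℕ.+ toℕ k →
                       A r k ≡ A r′ k′
      basement       : ∀ r k → toℕ k ℕ.+ m < toℕ r → A r k ≡ const 0#
      diag           : Vector Entry (suc m)
      diag-entries   : ∀ r k s → toℕ r ℕ.+ toℕ s ≡ toℕ k ℕ.+ m → A r k ≡ diag s
      diag-indet     : ∀ s → ∃ λ x → diag (Fin.suc s) ≡ indet x
      diag-distinct  : Injective _≡_ _≡_ diag
      attic-distinct : ∀ r k → toℕ r < toℕ k →
                       ∀ x → A r k ≡ indet x → ∀ s → diag s ≢ indet x

    blockType : BlockType
    blockType with diag Fin.zero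
    ... | indet _ = typeX
    ... | const a = if does (a ≟ 0#) then type0 else type1

  record Block (u : ℕ) : Set c where
    field
      width   : ℕ
      matrix  : Matrix Entry u width
      isSlant : IsSlant matrix
    open IsSlant isSlant public using (blockType)

  totalWidth : ∀ {u} → List (Block u) → ℕ
  totalWidth = ListAction.sum ∘ List.map Block.width

  juxtapose : ∀ {u} (Bs : List (Block u)) → Matrix Entry u (totalWidth Bs)
  juxtapose []       r = Vector.[]
  juxtapose (B ∷ Bs) r = Block.matrix B r Vector.++ juxtapose Bs r

  record Multislant (u : ℕ) : Set c where
    field
      blocks           : List (Block u)
      pairwiseDisjoint : AllPairs (λ B C → Disjoint (Block.matrix B) (Block.matrix C)) blocks

    width : ℕ
    width = totalWidth blocks

    matrix : Matrix Entry u width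
    matrix = juxtapose blocks

    signature : ℕ × ℕ × ℕ
    signature = tally (List.map Block.blockType blocks)

  IsSquare : ∀ {u} → Multislant u → Set
  IsSquare {u} M = Multislant.width M ≡ u

  squareMatrix : ∀ {n} (M : Multislant n) → IsSquare M → Matrix Entry n n
  squareMatrix M sq r k = Multislant.matrix M r (cast (sym sq) k)

  indet? : Entry → Maybe Indet
  indet? (indet x) = just x
  indet? (const a) = nothing

  indeterminates : ∀ {u v} → Matrix Entry u v → List Indet
  indeterminates A =
    deduplicate ℕₚ._≟_ (mapMaybe indet? (cartesianProductWith A (allFin _) (allFin _)))

  Assignment : Set c
  Assignment = Indet → Carrier

  _[_↦_] : Assignment → Indet → Carrier → Assignment
  (ρ [ x ↦ a ]) y = if does (y ℕₚ.≟ x) then a else ρ y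

  -- All assignments of field elements to the indeterminates in a
  -- duplicate-free list, each listed once; every other indeterminate is sent
  -- to 0#.
  assignments : List Indet → List Assignment
  assignments []       = (λ _ → 0#) ∷ []
  assignments (x ∷ xs) = cartesianProductWith (λ a ρ → ρ [ x ↦ a ]) elements (assignments xs)

  evaluate : Assignment → Entry → Carrier
  evaluate ρ (indet x) = ρ x
  evaluate ρ (const a) = a

  substitute : ∀ {u v} → Assignment → Matrix Entry u v → Matrix Carrier u v
  substitute ρ A r k = evaluate ρ (A r k)

  -- The sample space assignments xs has q ^ length xs elements.
  SiPr : ∀ {n} (M : Multislant n) → IsSquare M → ℚ
  SiPr M sq = length (filter (λ ρ → det (substitute ρ A) ≟ 0#) (assignments xs)) /q^ length xs
    where
    A  = squareMatrix M sq
    xs = indeterminates A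

  γ : ℕ → ℚ
  γ 0             = 1ℚ
  γ 1             = 1ℚ
  γ (suc (suc k)) = γ (suc k) ℚ.* (1ℚ ℚ.- 1 /q^ suc k)

{-# OPTIONS --safe #-}
module Submission where

open import Defs
open import Algebra.Bundles using (CommutativeRing; module Semiring)
import Algebra.Properties.Semiring.Sum as SemiringSum
import Algebra.Solver.Ring.NaturalCoefficients.Default as SemiringSolver
open import Data.Bool.Base using (true; false; if_then_else_)
open import Data.Fin.Base using (Fin; zero; suc; toℕ; inject₁; inject≤; punchIn; punchOut; fromℕ<; opposite; cast; splitAt; _↑ˡ_; _↑ʳ_)
open import Data.Fin.Permutation as FinPerm using (reverse)
import Data.Fin.Properties as Finₚ
open import Data.Integer.Base as ℤ using () renaming (+_ to pos)
import Data.Integer.Properties as ℤₚ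
open import Data.List.Base as List using (List; []; _∷_; _++_; length; filter; allFin; cartesianProductWith; mapMaybe)
import Data.List.Membership.Propositional.Properties as ∈ₚ
open import Data.List.Membership.Propositional using (_∈_; _∉_)
import Data.List.Properties as Listₚ
open import Data.List.Relation.Binary.Permutation.Propositional as Perm using (_↭_; ↭-sym)
import Data.List.Relation.Binary.Permutation.Propositional.Properties as Permₚ
open import Data.List.Relation.Binary.Pointwise using (Pointwise; []; _∷_)
open import Data.List.Relation.Unary.All as All using (All; []; _∷_)
open import Data.List.Relation.Unary.AllPairs using (AllPairs; []; _∷_)
open import Data.List.Relation.Unary.Any using (here; there)
import Data.List.Relation.Unary.Unique.DecPropositional.Properties as UniqueDecₚ
open import Data.List.Relation.Unary.Unique.Propositional using (Unique)
import Data.List.Relation.Unary.Unique.Propositional.Properties as Uniqueₚ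
open import Data.Maybe.Base using (Maybe; just; nothing)
open import Data.Nat.Base as ℕ using (ℕ; zero; suc; z≤n; s≤s; _≤_; _<_; _∸_; _^_; NonZero)
import Data.Nat.ListAction as ListAction
import Data.Nat.ListAction.Properties as ListActionₚ
import Data.Nat.Properties as ℕₚ
open import Data.Nat.Solver using () renaming (module +-*-Solver to ℕSolver)
open import Data.Product.Base using (∃; ∃₂; _×_; _,_; proj₁; proj₂)
open import Data.Rational.Base using (ℚ; 0ℚ; 1ℚ; toℚᵘ; fromℚᵘ)
import Data.Rational.Properties as ℚₚ
open import Data.Rational.Solver using () renaming (module +-*-Solver to ℚSolver)
open import Data.Rational.Unnormalised.Base as ℚᵘ using (mkℚᵘ; *≡*)
import Data.Rational.Unnormalised.Properties as ℚᵘₚ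
open import Data.Sum.Base using (_⊎_; inj₁; inj₂; [_,_]′)
open import Data.Vec.Functional as Vector using (Vector; removeAt; updateAt) renaming (_∷_ to _∷ᵛ_)
open import Data.Vec.Functional.Properties using (updateAt-updates; updateAt-minimal)
open import Function.Base using (_∘_; id)
open import Function.Bundles using (_⇔_; mk⇔; module Equivalence; module Inverse)
open import Relation.Binary.PropositionalEquality using (_≡_; _≢_; _≗_; refl; sym; trans; cong; cong₂; subst; module ≡-Reasoning)
open import Relation.Nullary using (¬_; Dec; yes; no; does; contradiction)
open import Relation.Nullary.Decidable using (map′; ¬?; dec-true; dec-false)
open import Relation.Unary using (Pred; Decidable)

-- Read from its bottom right corner upwards, the column of a block with v columns which is the c-th from the right
-- is x^c g modulo x^n, where the power series g = u₀ + u₁ x + … + u_m x^m + (attic) is the last column.  So M is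
-- nonsingular iff Σ p_t g_t ≡ 0 mod x^n with deg p_t < v_t forces all p_t = 0.  If every u₀ vanishes, then M is
-- singular.  Otherwise let t be the block of greatest width among those with u₀ ≠ 0 and subtract multiples of g_t
-- from the other series so that their constant terms vanish.  This only translates the random coefficients, and it
-- keeps the attic constant because t is the widest.  Dividing the cleared series by x leaves a multislant matrix of
-- size n - 1 in which block t is one column narrower (or gone) and all the other blocks have type X, so that
-- induction on n gives the probability γ_k of being nonsingular, whatever the values of the u₀, as long as they are
-- not all zero; if block t is gone, this rests on γ_k = γ_{k-1} (1 - 1/q^(k-1)).  The u₀ are not all zero with
-- probability 1 - 0^ℓ/q^i.

-- The greatest width is needed twice. Clearing the other series replaces the unknown p_t by p_t
-- minus a combination of the other p_s, so these must obey the degree bound of p_t. And the attic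
-- of a narrower block starts no earlier in its series than that of t, so what is added to it comes
-- from the attic of t and is not random. A block with u₀ = 0 is exempt on both counts, because its
-- multiplier is 0. Which block serves as t depends on the values of the u₀. So the random u₀ are
-- fixed first and averaged at the end, which works because the formula is affine in the indicator
-- of each event u₀ = 0. Attic indeterminates may repeat within a block, so they are not treated as
-- independent coefficients: the probability is computed conditionally on them, and their values do
-- not enter the result. The induction runs on independence of truncated series, which ignores signs
-- and the order of the blocks. Determinants serve to decide this property and to connect it with
-- the statement.

-- Arithmetic and finite sums in the field.

module FieldAlgebra {c} (F : FiniteField c) where
  open FiniteField F using (Carrier; _+_; _*_; -_; 0#; 1#; 0≢1; inverse; _≟_; commutativeRing) public
  open CommutativeRing commutativeRing public using
    ( semiring; commutativeSemiring; +-congˡ; +-congʳ; +-assoc; +-comm; +-identityˡ; +-identityʳ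
    ; *-assoc; *-comm; *-identityˡ; *-identityʳ; zeroˡ; zeroʳ; distribʳ; -‿inverseʳ)
  open SemiringSum semiring public
    using (sum; sum-cong-≗; sum-remove; sum-permute; ∑-distrib-+; *-distribˡ-sum; sum-replicate-zero)
  open SemiringSolver commutativeSemiring public using (solve; _:=_; _:+_; _:*_; con)

  x*y≡0⇒y≡0 : ∀ {x y} → x ≢ 0# → x * y ≡ 0# → y ≡ 0#
  x*y≡0⇒y≡0 {x} {y} x≢0 xy≡0 with x⁻¹ , xx⁻¹≡1 ← inverse x x≢0 = begin
    y              ≡⟨ *-identityˡ y ⟨
    1# * y         ≡⟨ cong (_* y) xx⁻¹≡1 ⟨
    x * x⁻¹ * y    ≡⟨ solve 3 (λ a b c → a :* b :* c := b :* (a :* c)) refl x x⁻¹ y ⟩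
    x⁻¹ * (x * y)  ≡⟨ cong (x⁻¹ *_) xy≡0 ⟩
    x⁻¹ * 0#       ≡⟨ zeroʳ x⁻¹ ⟩
    0#             ∎
    where open ≡-Reasoning

  clearing : ∀ p → p ≢ 0# → ∀ a → ∃ λ k → a + k * p ≡ 0#
  clearing p p≢0 a with p⁻¹ , pp⁻¹≡1 ← inverse p p≢0 = - a * p⁻¹ , (begin
    a + - a * p⁻¹ * p    ≡⟨ solve 4 (λ a b c d → a :+ b :* c :* d := a :+ b :* (d :* c)) refl a (- a) p⁻¹ p ⟩
    a + - a * (p * p⁻¹)  ≡⟨ cong (λ z → a + - a * z) pp⁻¹≡1 ⟩
    a + - a * 1#         ≡⟨ cong (a +_) (*-identityʳ (- a)) ⟩
    a + - a              ≡⟨ -‿inverseʳ a ⟩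
    0#                   ∎)
    where open ≡-Reasoning

  sum-zero : ∀ {n} {f : Vector Carrier n} → (∀ i → f i ≡ 0#) → sum f ≡ 0#
  sum-zero {n} f≗0 = trans (sum-cong-≗ f≗0) (sum-replicate-zero n)

  sum-bump : ∀ {n} {f g : Vector Carrier n} i {a} →
             (∀ j → j ≢ i → f j ≡ g j) → f i ≡ g i + a → sum f ≡ sum g + a
  sum-bump {suc n} {f} {g} i {a} same bump = begin
    sum f                                ≡⟨ sum-remove f ⟩
    f i + sum (removeAt f i)             ≡⟨ cong₂ _+_ bump (sum-cong-≗ λ j → same _ (Finₚ.punchInᵢ≢i i j)) ⟩
    g i + a + sum (removeAt g i)         ≡⟨ solve 3 (λ x y z → x :+ y :+ z := x :+ z :+ y) refl (g i) a _ ⟩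
    g i + sum (removeAt g i) + a         ≡⟨ cong (_+ a) (sum-remove g) ⟨
    sum g + a                            ∎
    where open ≡-Reasoning

  sum-pair : ∀ {n} {f : Vector Carrier (suc n)} (i : Fin n) →
             (∀ j → j ≢ inject₁ i → j ≢ suc i → f j ≡ 0#) → f (inject₁ i) + f (suc i) ≡ 0# → sum f ≡ 0#
  sum-pair {suc n} {f} zero rest pair = begin
    f zero + (f (suc zero) + sum (λ j → f (suc (suc j))))
      ≡⟨ +-assoc _ _ _ ⟨
    f zero + f (suc zero) + sum (λ j → f (suc (suc j)))
      ≡⟨ cong₂ _+_ pair (sum-zero λ j → rest (suc (suc j)) (λ ()) (λ ())) ⟩
    0# + 0#
      ≡⟨ +-identityˡ 0# ⟩
    0# ∎
    where open ≡-Reasoning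
  sum-pair {suc n} {f} (suc i) rest pair = begin
    f zero + sum (f ∘ suc)  ≡⟨ cong₂ _+_ (rest zero (λ ()) (λ ()))
                                 (sum-pair i (λ j p q → rest (suc j) (p ∘ Finₚ.suc-injective) (q ∘ Finₚ.suc-injective)) pair) ⟩
    0# + 0#                 ≡⟨ +-identityˡ 0# ⟩
    0#                      ∎
    where open ≡-Reasoning

-- Determinants, column operations and trivial kernels.

module LinearAlgebra {c} (F : FiniteField c) where
  open FieldAlgebra F
  open OverField F using (det)
  open import Algebra.Definitions.RawSemiring (Semiring.rawSemiring semiring)
    using () renaming (_^_ to _^F_)

  minor : ∀ {u v} → Matrix Carrier (suc u) (suc v) → Fin (suc v) → Matrix Carrier u v
  minor A k r = removeAt (A (suc r)) k

  det-cong : ∀ {n} {A B : Matrix Carrier n n} → (∀ r c → A r c ≡ B r c) → det A ≡ det B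
  det-cong {zero}  A≗B = refl
  det-cong {suc n} A≗B = sum-cong-≗ λ k →
    cong ((- 1#) ^F toℕ k *_) (cong₂ _*_ (A≗B zero k) (det-cong λ r c → A≗B (suc r) (punchIn k c)))

  det-linear : ∀ {n} (s : Fin n) {A B C : Matrix Carrier n n} {t} →
               (∀ r c → c ≢ s → A r c ≡ C r c) → (∀ r c → c ≢ s → B r c ≡ C r c) →
               (∀ r → C r s ≡ A r s + t * B r s) → det C ≡ det A + t * det B
  det-linear {suc n} s {A} {B} {C} {t} A≗C B≗C Cₛ = begin
    det C                                          ≡⟨ sum-cong-≗ term ⟩
    sum (λ k → summand A k + t * summand B k)      ≡⟨ ∑-distrib-+ (summand A) (λ k → t * summand B k) ⟩
    det A + sum (λ k → t * summand B k)            ≡⟨ cong (det A +_) (*-distribˡ-sum t (summand B)) ⟨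
    det A + t * det B                              ∎
    where
    open ≡-Reasoning
    summand : Matrix Carrier (suc n) (suc n) → Fin (suc n) → Carrier
    summand A k = (- 1#) ^F toℕ k * (A zero k * det (minor A k))
    term : ∀ k → summand C k ≡ summand A k + t * summand B k
    term k with k Finₚ.≟ s
    ... | yes refl = begin
      e * (C zero k * D)                             ≡⟨ cong (λ z → e * (z * D)) (Cₛ zero) ⟩
      e * ((A zero k + t * B zero k) * D)            ≡⟨ solve 5 (λ e a t b d → e :* ((a :+ t :* b) :* d) := e :* (a :* d) :+ t :* (e :* (b :* d))) refl e _ t _ D ⟩
      e * (A zero k * D) + t * (e * (B zero k * D))  ≡⟨ cong₂ (λ x y → e * (A zero k * x) + t * (e * (B zero k * y)))
                                                          (det-cong λ r c → A≗C _ _ (Finₚ.punchInᵢ≢i k c))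
                                                          (det-cong λ r c → B≗C _ _ (Finₚ.punchInᵢ≢i k c)) ⟨
      summand A k + t * summand B k                  ∎
      where
      e = (- 1#) ^F toℕ k
      D = det (minor C k)
    ... | no k≢s = begin
      e * (C zero k * det (minor C k))               ≡⟨ cong (λ z → e * (C zero k * z))
                                                          (det-linear s′ (λ r c p → A≗C _ _ (away p)) (λ r c p → B≗C _ _ (away p))
                                                             λ r → subst (λ i → C (suc r) i ≡ A (suc r) i + t * B (suc r) i) (sym ↑s′≡s) (Cₛ (suc r))) ⟩
      e * (C zero k * (dA + t * dB))                 ≡⟨ solve 5 (λ e x a t b → e :* (x :* (a :+ t :* b)) := e :* (x :* a) :+ t :* (e :* (x :* b))) refl e _ dA t dB ⟩
      e * (C zero k * dA) + t * (e * (C zero k * dB)) ≡⟨ cong₂ (λ x y → e * (x * dA) + t * (e * (y * dB))) (A≗C zero k k≢s) (B≗C zero k k≢s) ⟨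
      summand A k + t * summand B k                  ∎
      where
      e  = (- 1#) ^F toℕ k
      dA = det (minor A k)
      dB = det (minor B k)
      s′ = punchOut k≢s
      ↑s′≡s : punchIn k s′ ≡ s
      ↑s′≡s = Finₚ.punchIn-punchOut k≢s
      away : ∀ {c} → c ≢ s′ → punchIn k c ≢ s
      away c≢s′ p = c≢s′ (Finₚ.punchIn-injective k _ _ (trans p (sym ↑s′≡s)))

  punchIn-adjacent : ∀ {n} (k : Fin (suc (suc n))) (i : Fin (suc n)) → k ≢ inject₁ i → k ≢ suc i →
                     ∃ λ j → punchIn k (inject₁ j) ≡ inject₁ i × punchIn k (suc j) ≡ suc i
  punchIn-adjacent zero          zero    p q = contradiction refl p
  punchIn-adjacent {suc n} zero  (suc i) p q = i , refl , refl
  punchIn-adjacent (suc zero)    zero    p q = contradiction refl q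
  punchIn-adjacent {suc n} (suc (suc k)) zero p q = zero , refl , refl
  punchIn-adjacent {suc n} (suc k) (suc i) p q
    with j , x , y ← punchIn-adjacent k i (p ∘ cong suc) (q ∘ cong suc) = suc j , cong suc x , cong suc y

  punchIn-suc-inject₁ : ∀ {n} (i j : Fin n) →
    punchIn (inject₁ i) j ≡ punchIn (suc i) j ⊎ punchIn (inject₁ i) j ≡ suc i × punchIn (suc i) j ≡ inject₁ i
  punchIn-suc-inject₁ zero    zero    = inj₂ (refl , refl)
  punchIn-suc-inject₁ zero    (suc j) = inj₁ refl
  punchIn-suc-inject₁ (suc i) zero    = inj₁ refl
  punchIn-suc-inject₁ (suc i) (suc j) with punchIn-suc-inject₁ i j
  ... | inj₁ p       = inj₁ (cong suc p)
  ... | inj₂ (p , q) = inj₂ (cong suc p , cong suc q)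

  -- In the expansion, a minor that deletes some other column still has two equal neighbours and
  -- vanishes by induction. The two remaining minors coincide and carry opposite signs. For columns
  -- further apart the minors would differ by a cyclic shift, whose sign would have to be tracked.
  det-adjacent : ∀ {n} (A : Matrix Carrier (suc n) (suc n)) (i : Fin n) →
                 (∀ r → A r (inject₁ i) ≡ A r (suc i)) → det A ≡ 0#
  det-adjacent {suc n} A i equal = sum-pair i elsewhere cancel
    where
    open ≡-Reasoning
    elsewhere : ∀ k → k ≢ inject₁ i → k ≢ suc i → (- 1#) ^F toℕ k * (A zero k * det (minor A k)) ≡ 0#
    elsewhere k p q with j , x , y ← punchIn-adjacent k i p q = begin
      (- 1#) ^F toℕ k * (A zero k * det (minor A k))
        ≡⟨ cong (λ z → (- 1#) ^F toℕ k * (A zero k * z)) (det-adjacent (minor A k) j λ r →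
             trans (cong (A (suc r)) x) (trans (equal (suc r)) (sym (cong (A (suc r)) y)))) ⟩
      (- 1#) ^F toℕ k * (A zero k * 0#)
        ≡⟨ cong ((- 1#) ^F toℕ k *_) (zeroʳ _) ⟩
      (- 1#) ^F toℕ k * 0#
        ≡⟨ zeroʳ _ ⟩
      0# ∎
    minors : det (minor A (inject₁ i)) ≡ det (minor A (suc i))
    minors = det-cong λ r j → [ cong (A (suc r))
      , (λ (p , q) → trans (cong (A (suc r)) p) (trans (sym (equal (suc r))) (sym (cong (A (suc r)) q)))) ]′
      (punchIn-suc-inject₁ i j)
    cancel : (- 1#) ^F toℕ (inject₁ i) * (A zero (inject₁ i) * det (minor A (inject₁ i)))
           + (- 1#) ^F suc (toℕ i) * (A zero (suc i) * det (minor A (suc i))) ≡ 0#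
    cancel = begin
      (- 1#) ^F toℕ (inject₁ i) * (A zero (inject₁ i) * det (minor A (inject₁ i))) + - 1# * e * (a * D)
        ≡⟨ cong (_+ - 1# * e * (a * D)) (cong₂ _*_ (cong ((- 1#) ^F_) (Finₚ.toℕ-inject₁ i)) (cong₂ _*_ (equal zero) minors)) ⟩
      e * (a * D) + - 1# * e * (a * D)
        ≡⟨ cong (_+ - 1# * e * (a * D)) (*-identityˡ _) ⟨
      1# * (e * (a * D)) + - 1# * e * (a * D)
        ≡⟨ solve 4 (λ o m e x → o :* (e :* x) :+ m :* e :* x := (o :+ m) :* (e :* x)) refl 1# (- 1#) e (a * D) ⟩
      (1# + - 1#) * (e * (a * D))
        ≡⟨ cong (_* (e * (a * D))) (-‿inverseʳ 1#) ⟩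
      0# * (e * (a * D))
        ≡⟨ zeroˡ _ ⟩
      0# ∎
      where
      e = (- 1#) ^F toℕ i
      a = A zero (suc i)
      D = det (minor A (suc i))

  TrivialKernel : ∀ {u v} → Matrix Carrier u v → Set c
  TrivialKernel {v = v} A = ∀ (x : Vector Carrier v) → (∀ r → sum (λ k → A r k * x k) ≡ 0#) → ∀ k → x k ≡ 0#

  TrivialKernel-cong : ∀ {u v} (A B : Matrix Carrier u v) → (∀ r k → A r k ≡ B r k) → TrivialKernel A → TrivialKernel B
  TrivialKernel-cong A B A≗B tk x Bx≡0 = tk x λ r → trans (sum-cong-≗ λ k → cong (_* x k) (A≗B r k)) (Bx≡0 r)

  addColumn : ∀ {u v} → Fin v → Fin v → Carrier → Matrix Carrier u v → Matrix Carrier u v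
  addColumn s t a A r = updateAt (A r) s (_+ a * A r t)

  -- With `y` obtained from `x` by adding `a * x s` to its entry at `t`, the new matrix sends `x` to
  -- what `A` sends `y` to.
  TrivialKernel-addColumn : ∀ {u v} {s t : Fin v} {a} (A : Matrix Carrier u v) → s ≢ t →
                            TrivialKernel A → TrivialKernel (addColumn s t a A)
  TrivialKernel-addColumn {v = v} {s} {t} {a} A s≢t tk x A′x≡0 = x≡0
    where
    open ≡-Reasoning
    y : Vector Carrier v
    y = updateAt x t (_+ a * x s)
    common : ∀ r → Carrier
    common r = sum (λ k → A r k * x k)
    A′x : ∀ r → sum (λ k → addColumn s t a A r k * x k) ≡ common r + a * A r t * x s
    A′x r = sum-bump s (λ j j≢s → cong (_* x j) (updateAt-minimal j s (A r) j≢s))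
      (trans (cong (_* x s) (updateAt-updates s (A r))) (distribʳ (x s) (A r s) _))
    Ay : ∀ r → sum (λ k → A r k * y k) ≡ common r + a * A r t * x s
    Ay r = sum-bump t (λ j j≢t → cong (A r j *_) (updateAt-minimal j t x j≢t))
      (trans (cong (A r t *_) (updateAt-updates t x))
             (solve 4 (λ b xt a xs → b :* (xt :+ a :* xs) := b :* xt :+ a :* b :* xs) refl (A r t) (x t) a (x s)))
    y≡0 : ∀ k → y k ≡ 0#
    y≡0 = tk y λ r → trans (Ay r) (trans (sym (A′x r)) (A′x≡0 r))
    xₛ≡0 : x s ≡ 0#
    xₛ≡0 = trans (sym (updateAt-minimal s t x s≢t)) (y≡0 s)
    x≡0 : ∀ k → x k ≡ 0#
    x≡0 k with k Finₚ.≟ t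
    ... | no k≢t = trans (sym (updateAt-minimal k t x k≢t)) (y≡0 k)
    ... | yes refl = begin
      x t            ≡⟨ +-identityʳ (x t) ⟨
      x t + 0#       ≡⟨ cong (x t +_) (zeroʳ a) ⟨
      x t + a * 0#   ≡⟨ cong (λ z → x t + a * z) xₛ≡0 ⟨
      x t + a * x s  ≡⟨ updateAt-updates t x ⟨
      y t            ≡⟨ y≡0 t ⟩
      0#             ∎

  addColumn-undo : ∀ {u v} {s t : Fin v} {a} (A : Matrix Carrier u v) → s ≢ t →
                   ∀ r k → addColumn s t (- a) (addColumn s t a A) r k ≡ A r k
  addColumn-undo {s = s} {t} {a} A s≢t r k with k Finₚ.≟ s
  ... | no k≢s = trans (updateAt-minimal k s _ k≢s) (updateAt-minimal k s _ k≢s)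
  ... | yes refl = begin
    addColumn s t (- a) A′ r s          ≡⟨ updateAt-updates s (A′ r) ⟩
    A′ r s + - a * A′ r t               ≡⟨ cong₂ (λ x y → x + - a * y) (updateAt-updates s (A r)) (updateAt-minimal t s (A r) (s≢t ∘ sym)) ⟩
    A r s + a * A r t + - a * A r t     ≡⟨ solve 4 (λ x a b y → x :+ a :* y :+ b :* y := x :+ (a :+ b) :* y) refl (A r s) a (- a) (A r t) ⟩
    A r s + (a + - a) * A r t           ≡⟨ cong (λ z → A r s + z * A r t) (-‿inverseʳ a) ⟩
    A r s + 0# * A r t                  ≡⟨ cong (A r s +_) (zeroˡ _) ⟩
    A r s + 0#                          ≡⟨ +-identityʳ _ ⟩
    A r s                               ∎
    where
    open ≡-Reasoning
    A′ = addColumn s t a A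

  -- Column operations are confined to neighbours because `det-adjacent` covers just these.
  data Adjacent {v} : Fin (suc v) → Fin (suc v) → Set where
    leftwards  : ∀ i → Adjacent (inject₁ i) (suc i)
    rightwards : ∀ i → Adjacent (suc i) (inject₁ i)

  Adjacent⇒≢ : ∀ {v} {s t : Fin (suc v)} → Adjacent s t → s ≢ t
  Adjacent⇒≢ (leftwards i)  p = ℕₚ.1+n≢n (trans (sym (cong toℕ p)) (Finₚ.toℕ-inject₁ i))
  Adjacent⇒≢ (rightwards i) p = ℕₚ.1+n≢n (trans (cong toℕ p) (Finₚ.toℕ-inject₁ i))

  det-addColumn : ∀ {n} {s t : Fin (suc n)} {a} (A : Matrix Carrier (suc n) (suc n)) → Adjacent s t →
                  det (addColumn s t a A) ≡ det A
  det-addColumn {n} {s} {t} {a} A st = begin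
    det (addColumn s t a A)  ≡⟨ det-linear s {A} {B} {addColumn s t a A}
                                  (λ r c c≢s → sym (updateAt-minimal c s (A r) c≢s))
                                  (λ r c c≢s → trans (updateAt-minimal c s (A r) c≢s) (sym (updateAt-minimal c s (A r) c≢s)))
                                  (λ r → trans (updateAt-updates s (A r)) (cong (λ z → A r s + a * z) (sym (updateAt-updates s {λ _ → A r t} (A r))))) ⟩
    det A + a * det B        ≡⟨ cong (λ z → det A + a * z) (B≡0 st B (λ r → trans (updateAt-updates s {λ _ → A r t} (A r)) (sym (updateAt-minimal t s (A r) (Adjacent⇒≢ st ∘ sym))))) ⟩
    det A + a * 0#           ≡⟨ cong (det A +_) (zeroʳ a) ⟩
    det A + 0#               ≡⟨ +-identityʳ _ ⟩
    det A                    ∎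
    where
    open ≡-Reasoning
    B : Matrix Carrier (suc n) (suc n)
    B r = updateAt (A r) s (λ _ → A r t)
    B≡0 : ∀ {s t} → Adjacent s t → (B : Matrix Carrier (suc n) (suc n)) → (∀ r → B r s ≡ B r t) → det B ≡ 0#
    B≡0 (leftwards i)  B eq = det-adjacent B i eq
    B≡0 (rightwards i) B eq = det-adjacent B i (sym ∘ eq)

  infix 4 _⟶_
  -- Reachability by operations that preserve both the determinant and the triviality of the kernel,
  -- so that the two can be compared on a matrix whose first row is cleared.
  data _⟶_ {u v} : Matrix Carrier u (suc v) → Matrix Carrier u (suc v) → Set c where
    done : ∀ {A} → A ⟶ A
    step : ∀ {A B s t} a → Adjacent s t → addColumn s t a A ⟶ B → A ⟶ B

  ⟶-trans : ∀ {u v} {A B C : Matrix Carrier u (suc v)} → A ⟶ B → B ⟶ C → A ⟶ C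
  ⟶-trans done          ys = ys
  ⟶-trans (step a p xs) ys = step a p (⟶-trans xs ys)

  ⟶-TrivialKernel : ∀ {u v} {A B : Matrix Carrier u (suc v)} → A ⟶ B → TrivialKernel A → TrivialKernel B
  ⟶-TrivialKernel done          tk = tk
  ⟶-TrivialKernel (step a p xs) tk = ⟶-TrivialKernel xs (TrivialKernel-addColumn _ (Adjacent⇒≢ p) tk)

  ⟵-TrivialKernel : ∀ {u v} {A B : Matrix Carrier u (suc v)} → A ⟶ B → TrivialKernel B → TrivialKernel A
  ⟵-TrivialKernel done          tk = tk
  ⟵-TrivialKernel (step a p xs) tk = TrivialKernel-cong _ _ (addColumn-undo _ (Adjacent⇒≢ p))
    (TrivialKernel-addColumn _ (Adjacent⇒≢ p) (⟵-TrivialKernel xs tk))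

  ⟶-det : ∀ {n} {A B : Matrix Carrier (suc n) (suc n)} → A ⟶ B → det B ≡ det A
  ⟶-det done          = refl
  ⟶-det (step {A} a p xs) = trans (⟶-det xs) (det-addColumn A p)

  clearPair : ∀ {u v} (A : Matrix Carrier (suc u) (suc v)) (i : Fin v) →
              ∃ λ B → A ⟶ B × B zero (suc i) ≡ 0# × (∀ k → k ≢ inject₁ i → k ≢ suc i → B zero k ≡ A zero k)
  clearPair A i with A zero (suc i) ≟ 0# | A zero (inject₁ i) ≟ 0#
  ... | yes p | _ = A , done , p , λ _ _ _ → refl
  ... | no  p | no q with a , eq ← clearing (A zero (inject₁ i)) q (A zero (suc i)) =
    _ , step a (rightwards i) done , trans (updateAt-updates (suc i) (A zero)) eq ,
    λ k _ k≢ → updateAt-minimal k (suc i) (A zero) k≢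
  -- The left entry is 0 and cannot clear anything, so the right column is first added to the left
  -- one.
  ... | no  p | yes q = _ , step 1# (leftwards i) (step a (rightwards i) done) ,
    trans (updateAt-updates (suc i) (B zero)) eq ,
    λ k k≢ k≢′ → trans (updateAt-minimal k (suc i) (B zero) k≢′) (updateAt-minimal k (inject₁ i) (A zero) k≢)
    where
    B = addColumn (inject₁ i) (suc i) 1# A
    Bᵢ≢0 : B zero (inject₁ i) ≢ 0#
    Bᵢ≢0 eq = p (trans (sym (trans (cong₂ _+_ q (*-identityˡ _)) (+-identityˡ _)))
                       (trans (sym (updateAt-updates (inject₁ i) (A zero))) eq))
    a  = proj₁ (clearing (B zero (inject₁ i)) Bᵢ≢0 (B zero (suc i)))
    eq = proj₂ (clearing (B zero (inject₁ i)) Bᵢ≢0 (B zero (suc i)))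

  zeros-extend : ∀ {v} {a b : Vector Carrier (suc v)} (i : Fin v) {w} → toℕ i ≡ w → (∀ k → suc w < toℕ k → a k ≡ 0#) → b (suc i) ≡ 0# →
                 (∀ k → k ≢ inject₁ i → k ≢ suc i → b k ≡ a k) → ∀ k → w < toℕ k → b k ≡ 0#
  zeros-extend i refl zeros bᵢ≡0 same k i<k with k Finₚ.≟ suc i
  ... | yes refl = bᵢ≡0
  ... | no k≢ = trans (same k (λ { refl → ℕₚ.<-irrefl (sym (Finₚ.toℕ-inject₁ i)) i<k }) k≢)
                      (zeros k (ℕₚ.≤∧≢⇒< i<k (k≢ ∘ Finₚ.toℕ-injective ∘ sym)))

  clearRow : ∀ {u v} (A : Matrix Carrier (suc u) (suc v)) → ∃ λ B → A ⟶ B × (∀ k → B zero (suc k) ≡ 0#)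
  clearRow {u} {v} A = go v ℕₚ.≤-refl A (λ k v<k → contradiction (Finₚ.toℕ<n k) (ℕₚ.≤⇒≯ v<k))
    where
    -- `w` is the last place of the first row that may still be nonzero; its left neighbour is used
    -- to clear it.
    go : ∀ w → w ≤ v → (A : Matrix Carrier (suc u) (suc v)) → (∀ k → w < toℕ k → A zero k ≡ 0#) →
         ∃ λ B → A ⟶ B × (∀ k → B zero (suc k) ≡ 0#)
    go zero    _   A zeros = A , done , λ k → zeros (suc k) (s≤s z≤n)
    go (suc w) w<v A zeros
      with B , A⟶B , Bᵢ≡0 , same ← clearPair A (fromℕ< w<v)
      with C , B⟶C , Cₖ≡0 ← go w (ℕₚ.<⇒≤ w<v) B (zeros-extend (fromℕ< w<v) (Finₚ.toℕ-fromℕ< w<v) zeros Bᵢ≡0 same)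
      = C , ⟶-trans A⟶B B⟶C , Cₖ≡0

  TrivialKernel-minor : ∀ {u v} (A : Matrix Carrier (suc u) (suc v)) → (∀ k → A zero (suc k) ≡ 0#) →
                        TrivialKernel A → TrivialKernel (minor A zero)
  TrivialKernel-minor A zeros tk x mx≡0 k = tk (0# ∷ᵛ x)
    (λ { zero    → trans (cong₂ _+_ (zeroʳ _) (sum-zero λ k → trans (cong (_* x k) (zeros k)) (zeroˡ _))) (+-identityˡ 0#)
       ; (suc r) → trans (cong₂ _+_ (zeroʳ _) (mx≡0 r)) (+-identityˡ 0#) }) (suc k)

  TrivialKernel-minor⁻¹ : ∀ {u v} (A : Matrix Carrier (suc u) (suc v)) → (∀ k → A zero (suc k) ≡ 0#) → A zero zero ≢ 0# →
                          TrivialKernel (minor A zero) → TrivialKernel A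
  TrivialKernel-minor⁻¹ A zeros a≢0 tk x Ax≡0 = λ { zero → x₀≡0 ; (suc k) → tk (x ∘ suc) rows k }
    where
    open ≡-Reasoning
    x₀≡0 : x zero ≡ 0#
    x₀≡0 = x*y≡0⇒y≡0 a≢0 (begin
      A zero zero * x zero                                             ≡⟨ +-identityʳ _ ⟨
      A zero zero * x zero + 0#                                        ≡⟨ +-congˡ (sum-zero λ k → trans (cong (_* x (suc k)) (zeros k)) (zeroˡ _)) ⟨
      A zero zero * x zero + sum (λ k → A zero (suc k) * x (suc k))    ≡⟨ Ax≡0 zero ⟩
      0#                                                               ∎)
    rows : ∀ r → sum (λ k → A (suc r) (suc k) * x (suc k)) ≡ 0#
    rows r = begin
      sum (λ k → A (suc r) (suc k) * x (suc k))                               ≡⟨ +-identityˡ _ ⟨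
      0# + sum (λ k → A (suc r) (suc k) * x (suc k))                          ≡⟨ cong (_+ sum (λ k → A (suc r) (suc k) * x (suc k))) (trans (cong (A (suc r) zero *_) x₀≡0) (zeroʳ _)) ⟨
      A (suc r) zero * x zero + sum (λ k → A (suc r) (suc k) * x (suc k))     ≡⟨ Ax≡0 (suc r) ⟩
      0#                                                                      ∎

  -- Clearing the first row and removing it together with the first column keeps the matrix wider
  -- than tall, down to a matrix without rows.
  wide⇒¬TrivialKernel : ∀ {u v} → u < v → (A : Matrix Carrier u v) → ¬ TrivialKernel A
  wide⇒¬TrivialKernel {zero}  {suc v} _ A tk = 0≢1 (sym (tk (λ _ → 1#) (λ ()) zero))
  wide⇒¬TrivialKernel {suc u} {suc v} (s≤s u<v) A tk with B , A⟶B , zeros ← clearRow A =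
    wide⇒¬TrivialKernel u<v (minor B zero) (TrivialKernel-minor B zeros (⟶-TrivialKernel A⟶B tk))

  det-clear : ∀ {n} (A : Matrix Carrier (suc n) (suc n)) → (∀ k → A zero (suc k) ≡ 0#) →
              det A ≡ A zero zero * det (minor A zero)
  det-clear A zeros = trans (cong₂ _+_ (*-identityˡ _) (sum-zero λ k →
    trans (cong (λ z → (- 1#) ^F suc (toℕ k) * (z * det (minor A (suc k)))) (zeros k))
          (trans (cong ((- 1#) ^F suc (toℕ k) *_) (zeroˡ _)) (zeroʳ _)))) (+-identityʳ _)

  TrivialKernel⇒det≢0 : ∀ {n} (A : Matrix Carrier n n) → TrivialKernel A → det A ≢ 0#
  TrivialKernel⇒det≢0 {zero}  A tk = 0≢1 ∘ sym
  TrivialKernel⇒det≢0 {suc n} A tk det≡0 with B , A⟶B , zeros ← clearRow A with B zero zero ≟ 0#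
  ... | no  b≢0 = TrivialKernel⇒det≢0 (minor B zero) (TrivialKernel-minor B zeros (⟶-TrivialKernel A⟶B tk))
    (x*y≡0⇒y≡0 b≢0 (trans (sym (det-clear B zeros)) (trans (⟶-det A⟶B) det≡0)))
  -- The first row of `B` is zero, so the kernel is that of the other `n` rows, which have `n + 1`
  -- columns.
  ... | yes b≡0 = wide⇒¬TrivialKernel (ℕₚ.n<1+n n) (B ∘ suc) λ x Bx≡0 → ⟶-TrivialKernel A⟶B tk x
    λ { zero    → sum-zero {f = λ k → B zero k * x k} λ { zero    → trans (cong (_* x zero) b≡0) (zeroˡ _)
                             ; (suc k) → trans (cong (_* x (suc k)) (zeros k)) (zeroˡ _) }
      ; (suc r) → Bx≡0 r }

  det≢0⇒TrivialKernel : ∀ {n} (A : Matrix Carrier n n) → det A ≢ 0# → TrivialKernel A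
  det≢0⇒TrivialKernel {zero}  A _ x _ ()
  det≢0⇒TrivialKernel {suc n} A det≢0 with B , A⟶B , zeros ← clearRow A with B zero zero ≟ 0#
  ... | no  b≢0 = ⟵-TrivialKernel A⟶B (TrivialKernel-minor⁻¹ B zeros b≢0 (det≢0⇒TrivialKernel (minor B zero)
    λ m≡0 → det≢0 (trans (sym (⟶-det A⟶B)) (trans (det-clear B zeros) (trans (cong (B zero zero *_) m≡0) (zeroʳ _))))))
  ... | yes b≡0 = contradiction
    (trans (sym (⟶-det A⟶B)) (trans (det-clear B zeros) (trans (cong (_* det (minor B zero)) b≡0) (zeroˡ _)))) det≢0

-- Families of power series and their reduction by a pivot.

module Generators {c} (F : FiniteField c) where
  open FieldAlgebra F
  open LinearAlgebra F
  open OverField F using (det)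

  Seq : Set c
  Seq = ℕ → Carrier

  infixr 5 _∷ˢ_
  _∷ˢ_ : Carrier → Seq → Seq
  (a ∷ˢ s) zero    = a
  (a ∷ˢ s) (suc i) = s i

  tl : Seq → Seq
  tl s i = s (suc i)

  infixl 7 _⋆_
  -- The Cauchy product, through p g = p₀ g + x (tl p) g.
  _⋆_ : Seq → Seq → Seq
  (p ⋆ g) zero    = p 0 * g 0
  (p ⋆ g) (suc i) = p 0 * g (suc i) + (tl p ⋆ g) i

  ⋆-cong : ∀ {p p′ g g′} → p ≗ p′ → g ≗ g′ → p ⋆ g ≗ p′ ⋆ g′
  ⋆-cong p≗p′ g≗g′ zero    = cong₂ _*_ (p≗p′ 0) (g≗g′ 0)
  ⋆-cong p≗p′ g≗g′ (suc i) = cong₂ _+_ (cong₂ _*_ (p≗p′ 0) (g≗g′ (suc i))) (⋆-cong (p≗p′ ∘ suc) g≗g′ i)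

  ⋆-zeroˡ : ∀ {p} → (∀ i → p i ≡ 0#) → ∀ g i → (p ⋆ g) i ≡ 0#
  ⋆-zeroˡ p≡0 g zero    = trans (cong (_* g 0) (p≡0 0)) (zeroˡ _)
  ⋆-zeroˡ p≡0 g (suc i) = trans (cong₂ _+_ (trans (cong (_* g (suc i)) (p≡0 0)) (zeroˡ _)) (⋆-zeroˡ (p≡0 ∘ suc) g i)) (+-identityˡ 0#)

  ⋆-distribʳ : ∀ p k p′ g i → ((λ j → p j + k * p′ j) ⋆ g) i ≡ (p ⋆ g) i + k * (p′ ⋆ g) i
  ⋆-distribʳ p k p′ g zero    = solve 4 (λ a k b x → (a :+ k :* b) :* x := a :* x :+ k :* (b :* x)) refl (p 0) k (p′ 0) (g 0)
  ⋆-distribʳ p k p′ g (suc i) = trans (+-congˡ (⋆-distribʳ (tl p) k (tl p′) g i))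
    (solve 6 (λ a k b x y z → (a :+ k :* b) :* x :+ (y :+ k :* z) := a :* x :+ y :+ k :* (b :* x :+ z)) refl
       (p 0) k (p′ 0) (g (suc i)) ((tl p ⋆ g) i) ((tl p′ ⋆ g) i))

  ⋆-distribˡ : ∀ p g k g′ i → (p ⋆ (λ j → g j + k * g′ j)) i ≡ (p ⋆ g) i + k * (p ⋆ g′) i
  ⋆-distribˡ p g k g′ zero    = solve 4 (λ a x k y → a :* (x :+ k :* y) := a :* x :+ k :* (a :* y)) refl (p 0) (g 0) k (g′ 0)
  ⋆-distribˡ p g k g′ (suc i) = trans (+-congˡ (⋆-distribˡ (tl p) g k g′ i))
    (solve 6 (λ a x k y u v → a :* (x :+ k :* y) :+ (u :+ k :* v) := a :* x :+ u :+ k :* (a :* y :+ v)) refl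
       (p 0) (g (suc i)) k (g′ (suc i)) ((tl p ⋆ g) i) ((tl p ⋆ g′) i))

  ⋆-tlˡ : ∀ {p} → p 0 ≡ 0# → ∀ g i → (p ⋆ g) (suc i) ≡ (tl p ⋆ g) i
  ⋆-tlˡ p₀≡0 g i = trans (+-congʳ (trans (cong (_* g (suc i)) p₀≡0) (zeroˡ _))) (+-identityˡ _)

  ⋆-tlʳ : ∀ p {g} → g 0 ≡ 0# → ∀ i → (p ⋆ g) (suc i) ≡ (p ⋆ tl g) i
  ⋆-tlʳ p g₀≡0 zero    = trans (+-congˡ (trans (cong (p 1 *_) g₀≡0) (zeroʳ _))) (+-identityʳ _)
  ⋆-tlʳ p g₀≡0 (suc i) = +-congˡ (⋆-tlʳ (tl p) g₀≡0 i)

  -- (v , g) stands for the v columns g, x g, …, x^(v-1) g of power series.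
  Generator : Set c
  Generator = ℕ × Seq

  Bounded : Generator → Seq → Set c
  Bounded (v , _) p = ∀ i → v ≤ i → p i ≡ 0#

  Zero : Seq → Set c
  Zero p = ∀ i → p i ≡ 0#

  comb : List Generator → List Seq → Seq
  comb []             _        i = 0#
  comb (_       ∷ _)  []       i = 0#
  comb ((_ , g) ∷ gs) (p ∷ ps) i = (p ⋆ g) i + comb gs ps i

  Independent : ℕ → List Generator → Set c
  Independent n gs = ∀ ps → Pointwise Bounded gs ps → (∀ i → i < n → comb gs ps i ≡ 0#) → All Zero ps

  _≈ᵍ_ : Generator → Generator → Set c
  (v , g) ≈ᵍ (v′ , g′) = v ≡ v′ × g ≗ g′

  Independent-cong : ∀ {n gs gs′} → Pointwise _≈ᵍ_ gs gs′ → Independent n gs → Independent n gs′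
  Independent-cong {n} {gs} {gs′} gs≈gs′ ind ps bs comb≡0 =
    ind ps (bounds gs≈gs′ bs) λ i i<n → trans (combs gs≈gs′ ps i) (comb≡0 i i<n)
    where
    bounds : ∀ {gs gs′ ps} → Pointwise _≈ᵍ_ gs gs′ → Pointwise Bounded gs′ ps → Pointwise Bounded gs ps
    bounds []                 []       = []
    bounds ((refl , _) ∷ eqs) (b ∷ bs) = b ∷ bounds eqs bs
    combs : ∀ {gs gs′} → Pointwise _≈ᵍ_ gs gs′ → ∀ ps i → comb gs ps i ≡ comb gs′ ps i
    combs []               ps       i = refl
    combs (_ ∷ _)          []       i = refl
    combs ((_ , eq) ∷ eqs) (p ∷ ps) i = cong₂ _+_ (⋆-cong (λ _ → refl) eq i) (combs eqs ps i)

  permute : ∀ {gs gs′} → gs ↭ gs′ → ∀ {ps} → Pointwise Bounded gs ps →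
            ∃ λ ps′ → Pointwise Bounded gs′ ps′ × (∀ i → comb gs′ ps′ i ≡ comb gs ps i) × (All Zero ps′ → All Zero ps)
  permute Perm.refl bs = _ , bs , (λ _ → refl) , λ zs → zs
  permute (Perm.prep x σ) (b ∷ bs) with _ , bs′ , same , back ← permute σ bs =
    _ , b ∷ bs′ , (λ i → +-congˡ (same i)) , λ { (z ∷ zs) → z ∷ back zs }
  permute (Perm.swap x y σ) (b ∷ b′ ∷ bs) with _ , bs′ , same , back ← permute σ bs =
    _ , b′ ∷ b ∷ bs′ ,
    (λ i → trans (cong (λ z → _ + (_ + z)) (same i)) (solve 3 (λ x y z → x :+ (y :+ z) := y :+ (x :+ z)) refl _ _ _)) ,
    λ { (z ∷ z′ ∷ zs) → z′ ∷ z ∷ back zs }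
  permute (Perm.trans σ τ) bs with _ , bs′ , same , back ← permute σ bs
                              with _ , bs″ , same′ , back′ ← permute τ bs′ =
    _ , bs″ , (λ i → trans (same′ i) (same i)) , back ∘ back′

  Independent-↭ : ∀ {n gs gs′} → gs ↭ gs′ → Independent n gs → Independent n gs′
  Independent-↭ σ ind ps bs comb≡0 with ps′ , bs′ , same , back ← permute (↭-sym σ) bs =
    back (ind ps′ bs′ λ i i<n → trans (same i) (comb≡0 i i<n))

  Independent-drop : ∀ {n g gs} → Independent n ((0 , g) ∷ gs) ⇔ Independent n gs
  Independent-drop {n} {g} {gs} = mk⇔
    (λ ind ps bs comb≡0 → All-tail (ind ((λ _ → 0#) ∷ ps) ((λ _ _ → refl) ∷ bs) λ i i<n →
      trans (cong (_+ comb gs ps i) (⋆-zeroˡ (λ _ → refl) g i)) (trans (+-identityˡ _) (comb≡0 i i<n))))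
    (λ { ind (p ∷ ps) (b ∷ bs) comb≡0 → (λ i → b i z≤n) ∷ ind ps bs λ i i<n →
      trans (sym (trans (cong (_+ comb gs ps i) (⋆-zeroˡ (λ i → b i z≤n) g i)) (+-identityˡ _))) (comb≡0 i i<n) })
    where
    All-tail : ∀ {p ps} → All Zero (p ∷ ps) → All Zero ps
    All-tail (_ ∷ zs) = zs

  -- The scalar from `clearing`, with the default 0 at p = 0 so that `reduce` can be defined without
  -- a proof that the pivot is nonzero.
  multiplier : Carrier → Carrier → Carrier
  multiplier p a with p ≟ 0#
  ... | yes _   = 0#
  ... | no  p≢0 = proj₁ (clearing p p≢0 a)

  multiplier-clears : ∀ {p} → p ≢ 0# → ∀ a → a + multiplier p a * p ≡ 0#
  multiplier-clears {p} p≢0 a with p ≟ 0#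
  ... | yes p≡0 = contradiction p≡0 p≢0
  ... | no  p≢0 = proj₂ (clearing p p≢0 a)

  -- The pivot leaves a series with zero constant term alone; this is what admits blocks wider than
  -- the pivot when their u₀ is 0.
  multiplier-zero : ∀ {p} → p ≢ 0# → ∀ {a} → a ≡ 0# → multiplier p a ≡ 0#
  multiplier-zero {p} p≢0 {a} a≡0 = x*y≡0⇒y≡0 p≢0 (begin
    p * multiplier p a      ≡⟨ *-comm _ _ ⟩
    multiplier p a * p      ≡⟨ +-identityˡ _ ⟨
    0# + multiplier p a * p ≡⟨ +-congʳ a≡0 ⟨
    a + multiplier p a * p  ≡⟨ multiplier-clears p≢0 a ⟩
    0#                      ∎)
    where open ≡-Reasoning

  -- The series (g + κ t)/x, where κ kills the constant term.
  reduce : Seq → Generator → Generator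
  reduce t (v , g) = v , λ i → g (suc i) + multiplier (t 0) (g 0) * t (suc i)

  -- The polynomial K = Σ κ_g p_g, so that Σ p_g (g + κ_g t) = K t + Σ p_g g: clearing the other
  -- series shifts the coefficient of the pivot by K.
  combMultiplier : Seq → List Generator → List Seq → Seq
  combMultiplier t []             _        i = 0#
  combMultiplier t (_       ∷ _)  []       i = 0#
  combMultiplier t ((_ , g) ∷ gs) (p ∷ ps) i = combMultiplier t gs ps i + multiplier (t 0) (g 0) * p i

  module _ {t : Seq} (t₀≢0 : t 0 ≢ 0#) where

    private
      κ : Seq → Carrier
      κ g = multiplier (t 0) (g 0)

    comb-reduce-zero : ∀ gs ps → (combMultiplier t gs ps ⋆ t) 0 + comb gs ps 0 ≡ 0#
    comb-reduce-zero []             ps       = trans (+-identityʳ _) (zeroˡ _)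
    comb-reduce-zero (_       ∷ _)  []       = trans (+-identityʳ _) (zeroˡ _)
    comb-reduce-zero ((_ , g) ∷ gs) (p ∷ ps) = begin
      (K + κ g * p 0) * t 0 + (p 0 * g 0 + comb gs ps 0)
        ≡⟨ solve 6 (λ K k p t g x → (K :+ k :* p) :* t :+ (p :* g :+ x) := K :* t :+ x :+ p :* (g :+ k :* t)) refl K (κ g) (p 0) (t 0) (g 0) _ ⟩
      K * t 0 + comb gs ps 0 + p 0 * (g 0 + κ g * t 0)
        ≡⟨ cong₂ _+_ (comb-reduce-zero gs ps) (trans (cong (p 0 *_) (multiplier-clears t₀≢0 (g 0))) (zeroʳ _)) ⟩
      0# + 0#
        ≡⟨ +-identityˡ 0# ⟩
      0# ∎
      where
      open ≡-Reasoning
      K = combMultiplier t gs ps 0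

    comb-reduce-suc : ∀ gs ps i → (combMultiplier t gs ps ⋆ t) (suc i) + comb gs ps (suc i) ≡ comb (List.map (reduce t) gs) ps i
    comb-reduce-suc []             ps       i = trans (+-identityʳ _) (⋆-zeroˡ (λ _ → refl) t (suc i))
    comb-reduce-suc (_       ∷ _)  []       i = trans (+-identityʳ _) (⋆-zeroˡ (λ _ → refl) t (suc i))
    comb-reduce-suc ((_ , g) ∷ gs) (p ∷ ps) i = begin
      ((λ j → K j + κ g * p j) ⋆ t) (suc i) + ((p ⋆ g) (suc i) + comb gs ps (suc i))
        ≡⟨ +-congʳ (⋆-distribʳ K (κ g) p t (suc i)) ⟩
      (K ⋆ t) (suc i) + κ g * (p ⋆ t) (suc i) + ((p ⋆ g) (suc i) + comb gs ps (suc i))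
        ≡⟨ solve 5 (λ x k y z w → x :+ k :* y :+ (z :+ w) := z :+ k :* y :+ (x :+ w)) refl ((K ⋆ t) (suc i)) (κ g) ((p ⋆ t) (suc i)) ((p ⋆ g) (suc i)) _ ⟩
      (p ⋆ g) (suc i) + κ g * (p ⋆ t) (suc i) + ((K ⋆ t) (suc i) + comb gs ps (suc i))
        ≡⟨ +-congʳ (⋆-distribˡ p g (κ g) t (suc i)) ⟨
      (p ⋆ (λ j → g j + κ g * t j)) (suc i) + ((K ⋆ t) (suc i) + comb gs ps (suc i))
        ≡⟨ cong₂ _+_ (⋆-tlʳ p (multiplier-clears t₀≢0 (g 0)) i) (comb-reduce-suc gs ps i) ⟩
      (p ⋆ (λ j → g (suc j) + κ g * t (suc j))) i + comb (List.map (reduce t) gs) ps i ∎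
      where
      open ≡-Reasoning
      K = combMultiplier t gs ps

    -- Either alternative makes `κ g * p i` vanish for i ≥ w, so that K obeys the degree bound of
    -- the pivot.
    Reducible : ℕ → Generator → Set c
    Reducible w (v , g) = v ≤ w ⊎ g 0 ≡ 0#

    combMultiplier-bounded : ∀ {w gs ps} → All (Reducible w) gs → Pointwise Bounded gs ps →
                             ∀ i → w ≤ i → combMultiplier t gs ps i ≡ 0#
    combMultiplier-bounded []       []       i w≤i = refl
    combMultiplier-bounded {gs = (v , g) ∷ gs} {p ∷ ps} (r ∷ rs) (b ∷ bs) i w≤i =
      trans (cong₂ _+_ (combMultiplier-bounded rs bs i w≤i) (term r)) (+-identityˡ 0#)
      where
      term : v ≤ _ ⊎ g 0 ≡ 0# → κ g * p i ≡ 0#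
      term (inj₁ v≤w)  = trans (cong (κ g *_) (b i (ℕₚ.≤-trans v≤w w≤i))) (zeroʳ _)
      term (inj₂ g₀≡0) = trans (cong (_* p i) (multiplier-zero t₀≢0 g₀≡0)) (zeroˡ _)

    combMultiplier-zero : ∀ gs {ps} → All Zero ps → Zero (combMultiplier t gs ps)
    combMultiplier-zero []       zs       i = refl
    combMultiplier-zero (_ ∷ _)  []       i = refl
    combMultiplier-zero ((_ , g) ∷ gs) (z ∷ zs) i =
      trans (cong₂ _+_ (combMultiplier-zero gs zs i) (trans (cong (κ g *_) (z i)) (zeroʳ _))) (+-identityˡ 0#)

    private
      reassemble : ∀ {p q : Seq} gs ps → (∀ i → p i ≡ q i + 1# * combMultiplier t gs ps i) →
                   ∀ i → (p ⋆ t) i + comb gs ps i ≡ (q ⋆ t) i + ((combMultiplier t gs ps ⋆ t) i + comb gs ps i)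
      reassemble {p} {q} gs ps p≗ i = trans (cong (_+ comb gs ps i)
        (trans (⋆-cong p≗ (λ _ → refl) i) (trans (⋆-distribʳ q 1# _ t i) (cong ((q ⋆ t) i +_) (*-identityˡ _))))) (+-assoc _ _ _)

    comb-pivot-zero : ∀ {p q : Seq} gs ps → (∀ i → p i ≡ q i + 1# * combMultiplier t gs ps i) →
                      (p ⋆ t) 0 + comb gs ps 0 ≡ q 0 * t 0
    comb-pivot-zero {p} {q} gs ps p≗ = trans (reassemble {p} {q} gs ps p≗ 0) (trans (+-congˡ (comb-reduce-zero gs ps)) (+-identityʳ _))

    comb-pivot-suc : ∀ {p q : Seq} gs ps → (∀ i → p i ≡ q i + 1# * combMultiplier t gs ps i) → q 0 ≡ 0# → ∀ i →
                     (p ⋆ t) (suc i) + comb gs ps (suc i) ≡ (tl q ⋆ t) i + comb (List.map (reduce t) gs) ps i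
    comb-pivot-suc {p} {q} gs ps p≗ q₀≡0 i = trans (reassemble {p} {q} gs ps p≗ (suc i)) (cong₂ _+_ (⋆-tlˡ {q} q₀≡0 t i) (comb-reduce-suc gs ps i))

    reduce-bounded⁺ : ∀ {gs ps} → Pointwise Bounded gs ps → Pointwise Bounded (List.map (reduce t) gs) ps
    reduce-bounded⁺ []       = []
    reduce-bounded⁺ (b ∷ bs) = b ∷ reduce-bounded⁺ bs

    reduce-bounded⁻ : ∀ gs {ps} → Pointwise Bounded (List.map (reduce t) gs) ps → Pointwise Bounded gs ps
    reduce-bounded⁻ []       []       = []
    reduce-bounded⁻ (_ ∷ gs) (b ∷ bs) = b ∷ reduce-bounded⁻ gs bs

    -- In terms of q = p - K the combination is q t + x Σ p_g (reduce t g). Its constant coefficient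
    -- q₀ t₀ has to vanish, so q is divisible by x and the quotient has one coefficient fewer: the
    -- pivot loses a column while the other widths stay.
    Independent-reduce : ∀ {n w gs} → All (Reducible (suc w)) gs →
      Independent (suc n) ((suc w , t) ∷ gs) ⇔ Independent n ((w , t) ∷ List.map (reduce t) gs)
    Independent-reduce {n} {w} {gs} rs = mk⇔ to from
      where
      to : Independent (suc n) ((suc w , t) ∷ gs) → Independent n ((w , t) ∷ List.map (reduce t) gs)
      to ind (q ∷ ps) (b ∷ bs) comb≡0 = conclude (ind (p ∷ ps) (bounded ∷ bs′) vanishes)
        where
        bs′ = reduce-bounded⁻ gs bs
        p : Seq
        -- The inverse substitution p = x q + K; the factor 1 fits the shape of `⋆-distribʳ`.
        p i = (0# ∷ˢ q) i + 1# * combMultiplier t gs ps i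
        bounded : Bounded (suc w , t) p
        bounded (suc i) (s≤s w≤i) = trans (cong₂ _+_ (b i w≤i) (trans (*-identityˡ _) (combMultiplier-bounded rs bs′ (suc i) (s≤s w≤i)))) (+-identityˡ 0#)
        vanishes : ∀ i → i < suc n → (p ⋆ t) i + comb gs ps i ≡ 0#
        vanishes zero    _         = trans (comb-pivot-zero {p} {0# ∷ˢ q} gs ps (λ _ → refl)) (zeroˡ _)
        vanishes (suc i) (s≤s i<n) = trans (comb-pivot-suc {p} {0# ∷ˢ q} gs ps (λ _ → refl) refl i) (comb≡0 i i<n)
        conclude : All Zero (p ∷ ps) → All Zero (q ∷ ps)
        conclude (z ∷ zs) = (λ i → trans (sym (trans (cong (q i +_) (trans (*-identityˡ _) (combMultiplier-zero gs zs (suc i)))) (+-identityʳ _)))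
                                         (z (suc i))) ∷ zs
      from : Independent n ((w , t) ∷ List.map (reduce t) gs) → Independent (suc n) ((suc w , t) ∷ gs)
      from ind (p ∷ ps) (b ∷ bs) comb≡0 = conclude (ind (tl q ∷ ps) (bounded ∷ reduce-bounded⁺ bs) vanishes)
        where
        open ≡-Reasoning
        K = combMultiplier t gs ps
        q : Seq
        q i = p i + - 1# * K i
        p≗ : ∀ i → p i ≡ q i + 1# * K i
        p≗ i = begin
          p i                             ≡⟨ +-identityʳ _ ⟨
          p i + 0#                        ≡⟨ cong (p i +_) (trans (cong (_* K i) (-‿inverseʳ 1#)) (zeroˡ _)) ⟨
          p i + (1# + - 1#) * K i         ≡⟨ solve 4 (λ p o m k → p :+ (o :+ m) :* k := p :+ m :* k :+ o :* k) refl (p i) 1# (- 1#) (K i) ⟩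
          p i + - 1# * K i + 1# * K i     ∎
        q₀≡0 : q 0 ≡ 0#
        q₀≡0 = x*y≡0⇒y≡0 t₀≢0 (trans (*-comm _ _) (trans (sym (comb-pivot-zero {p} {q} gs ps p≗)) (comb≡0 0 (s≤s z≤n))))
        bounded : Bounded (w , t) (tl q)
        bounded i w≤i = trans (cong₂ _+_ (b (suc i) (s≤s w≤i)) (trans (cong (- 1# *_) (combMultiplier-bounded rs bs (suc i) (s≤s w≤i))) (zeroʳ _))) (+-identityˡ 0#)
        vanishes : ∀ i → i < n → (tl q ⋆ t) i + comb (List.map (reduce t) gs) ps i ≡ 0#
        vanishes i i<n = trans (sym (comb-pivot-suc {p} {q} gs ps p≗ q₀≡0 i)) (comb≡0 (suc i) (s≤s i<n))
        conclude : All Zero (tl q ∷ ps) → All Zero (p ∷ ps)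
        conclude (z ∷ zs) = (λ i → trans (p≗ i) (trans (cong₂ _+_ (q≡0 i) (trans (*-identityˡ _) (combMultiplier-zero gs zs i))) (+-identityˡ 0#))) ∷ zs
          where
          q≡0 : Zero q
          q≡0 zero    = q₀≡0
          q≡0 (suc i) = z i

  -- The matrix of a family of generators and its kernel.

  shift : ℕ → Seq → Seq
  shift zero    g = g
  shift (suc k) g = 0# ∷ˢ shift k g

  slab : ∀ n v → Seq → Matrix Carrier n v
  slab n v g r k = shift (toℕ (opposite k)) g (toℕ (opposite r))

  sum-shift : ∀ {v p} g → (∀ i → v ≤ i → p i ≡ 0#) → ∀ i → sum {v} (λ k → shift (toℕ k) g i * p (toℕ k)) ≡ (p ⋆ g) i
  sum-shift {zero}  {p} g b i    = sym (⋆-zeroˡ (λ j → b j z≤n) g i)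
  sum-shift {suc v} {p} g b zero = trans (cong₂ _+_ (*-comm (g 0) (p 0)) (sum-zero {f = λ (k : Fin v) → 0# * p (suc (toℕ k))} λ k → zeroˡ _)) (+-identityʳ _)
  sum-shift {suc v} {p} g b (suc i) = cong₂ _+_ (*-comm _ _) (sum-shift g (λ j v≤j → b (suc j) (s≤s v≤j)) i)

  sum-++ : ∀ m {n} (f : Vector Carrier (m ℕ.+ n)) → sum f ≡ sum (λ i → f (i ↑ˡ n)) + sum (λ j → f (m ↑ʳ j))
  sum-++ zero    f = sym (+-identityˡ _)
  sum-++ (suc m) f = trans (cong (f zero +_) (sum-++ m (f ∘ suc))) (sym (+-assoc _ _ _))

  ++-↑ˡ : ∀ {a} {A : Set a} {m n} (xs : Vector A m) (ys : Vector A n) i → (xs Vector.++ ys) (i ↑ˡ n) ≡ xs i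
  ++-↑ˡ {m = m} {n} xs ys i = cong [ xs , ys ]′ (Finₚ.splitAt-↑ˡ m i n)

  ++-↑ʳ : ∀ {a} {A : Set a} {m n} (xs : Vector A m) (ys : Vector A n) j → (xs Vector.++ ys) (m ↑ʳ j) ≡ ys j
  ++-↑ʳ {m = m} {n} xs ys j = cong [ xs , ys ]′ (Finₚ.splitAt-↑ʳ m n j)

  totalSize : List Generator → ℕ
  totalSize gs = ListAction.sum (List.map proj₁ gs)

  extend : ∀ {v} → Vector Carrier v → Seq
  extend {zero}  x i       = 0#
  extend {suc v} x zero    = x zero
  extend {suc v} x (suc i) = extend (x ∘ suc) i

  extend-toℕ : ∀ {v} (x : Vector Carrier v) k → extend x (toℕ k) ≡ x k
  extend-toℕ x zero    = refl
  extend-toℕ x (suc k) = extend-toℕ (x ∘ suc) k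

  extend-≥ : ∀ {v} (x : Vector Carrier v) i → v ≤ i → extend x i ≡ 0#
  extend-≥ {zero}  x i       _         = refl
  extend-≥ {suc v} x (suc i) (s≤s v≤i) = extend-≥ (x ∘ suc) i v≤i

  -- Parametrised by an index type so as to serve bare generators, generators divided by x, and
  -- blocks. For blocks the number of columns is then definitionally that of the multislant matrix.
  module Slabs {X : Set c} (generator : X → Generator) where

    width : X → ℕ
    width b = proj₁ (generator b)

    series : X → Seq
    series b = proj₂ (generator b)

    totalWidth : List X → ℕ
    totalWidth bs = ListAction.sum (List.map width bs)

    slabs : ∀ n bs → Matrix Carrier n (totalWidth bs)
    slabs n []       r = Vector.[]
    slabs n (b ∷ bs) r = slab n (width b) (series b) r Vector.++ slabs n bs r

    -- A vector lists the coefficients of each polynomial in reverse, since columns count from the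
    -- right. A relation is convenient because vectors have to be built from polynomials as well as
    -- polynomials from vectors.
    data Matches : ∀ bs → Vector Carrier (totalWidth bs) → List Seq → Set c where
      []   : ∀ {x} → Matches [] x []
      cons : ∀ {b bs x p ps} → Bounded (generator b) p → (∀ k → x (k ↑ˡ totalWidth bs) ≡ p (toℕ (opposite k))) →
             Matches bs (λ j → x (width b ↑ʳ j)) ps → Matches (b ∷ bs) x (p ∷ ps)

    Matches-cong : ∀ {bs x y ps} → x ≗ y → Matches bs x ps → Matches bs y ps
    Matches-cong x≗y []            = []
    Matches-cong x≗y (cons b eq m) = cons b (λ k → trans (sym (x≗y _)) (eq k)) (Matches-cong (λ j → x≗y _) m)

    Matches⇒Bounded : ∀ {bs x ps} → Matches bs x ps → Pointwise Bounded (List.map generator bs) ps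
    Matches⇒Bounded []           = []
    Matches⇒Bounded (cons b _ m) = b ∷ Matches⇒Bounded m

    vector⇒Matches : ∀ bs x → ∃ (Matches bs x)
    vector⇒Matches []       x = [] , []
    vector⇒Matches (b ∷ bs) x with ps , m ← vector⇒Matches bs (λ j → x (width b ↑ʳ j)) =
      extend y ∷ ps ,
      cons (extend-≥ y) (λ k → trans (cong (λ i → x (i ↑ˡ _)) (sym (Finₚ.opposite-involutive k))) (sym (extend-toℕ y (opposite k)))) m
      where
      y : Vector Carrier (width b)
      y k = x (opposite k ↑ˡ totalWidth bs)

    Bounded⇒Matches : ∀ bs {ps} → Pointwise Bounded (List.map generator bs) ps → ∃ λ x → Matches bs x ps
    Bounded⇒Matches [] [] = (λ ()) , []
    Bounded⇒Matches (b ∷ bs) {p ∷ ps} (bd ∷ bds) with x , m ← Bounded⇒Matches bs bds =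
      y Vector.++ x , cons bd (++-↑ˡ y x) (Matches-cong (λ j → sym (++-↑ʳ y x j)) m)
      where
      y : Vector Carrier (width b)
      y k = p (toℕ (opposite k))

    slabs-comb : ∀ {n bs x ps} → Matches bs x ps → ∀ r →
                 sum (λ k → slabs n bs r k * x k) ≡ comb (List.map generator bs) ps (toℕ (opposite r))
    slabs-comb [] r = refl
    slabs-comb {n} {b ∷ bs} {x} {p ∷ ps} (cons bd eq m) r = begin
      sum (λ k → slabs n (b ∷ bs) r k * x k)
        ≡⟨ sum-++ v _ ⟩
      sum (λ k → slabs n (b ∷ bs) r (k ↑ˡ w) * x (k ↑ˡ w)) + sum (λ j → slabs n (b ∷ bs) r (v ↑ʳ j) * x (v ↑ʳ j))
        ≡⟨ cong₂ _+_ (sum-cong-≗ λ k → cong₂ _*_ (++-↑ˡ (slab n v g r) (slabs n bs r) k) (eq k))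
                     (sum-cong-≗ λ j → cong (_* x (v ↑ʳ j)) (++-↑ʳ (slab n v g r) (slabs n bs r) j)) ⟩
      sum {v} (λ k → shift (toℕ (opposite k)) g i * p (toℕ (opposite k))) + sum (λ j → slabs n bs r j * x (v ↑ʳ j))
        ≡⟨ cong₂ _+_ (sym (sum-permute (λ (k : Fin v) → shift (toℕ k) g i * p (toℕ k)) reverse)) (slabs-comb m r) ⟩
      sum {v} (λ k → shift (toℕ k) g i * p (toℕ k)) + comb (List.map generator bs) ps i
        ≡⟨ +-congʳ (sum-shift g bd i) ⟩
      (p ⋆ g) i + comb (List.map generator bs) ps i ∎
      where
      open ≡-Reasoning
      v = width b
      g = series b
      i = toℕ (opposite r)
      w = totalWidth bs

    Matches-zero⁺ : ∀ {bs x ps} → Matches bs x ps → (∀ k → x k ≡ 0#) → All Zero ps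
    Matches-zero⁺ [] x≡0 = []
    Matches-zero⁺ {b ∷ bs} {x} {p ∷ ps} (cons bd eq m) x≡0 = zero′ ∷ Matches-zero⁺ m (λ j → x≡0 _)
      where
      zero′ : Zero p
      zero′ i with i ℕₚ.<? width b
      ... | no  i≮v = bd i (ℕₚ.≮⇒≥ i≮v)
      ... | yes i<v = trans (cong p (sym (trans (cong toℕ (Finₚ.opposite-involutive k)) (Finₚ.toℕ-fromℕ< i<v))))
                            (trans (sym (eq (opposite k))) (x≡0 _))
        where k = fromℕ< i<v

    Matches-zero⁻ : ∀ {bs x ps} → Matches bs x ps → All Zero ps → ∀ k → x k ≡ 0#
    Matches-zero⁻ {b ∷ bs} {x} (cons bd eq m) (z ∷ zs) k with splitAt (width b) k in split
    ... | inj₁ i = trans (cong x (sym (Finₚ.splitAt⁻¹-↑ˡ split))) (trans (eq i) (z _))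
    ... | inj₂ j = trans (cong x (sym (Finₚ.splitAt⁻¹-↑ʳ split))) (Matches-zero⁻ m zs j)

    Independent⇔TrivialKernel : ∀ {n} bs → Independent n (List.map generator bs) ⇔ TrivialKernel (slabs n bs)
    Independent⇔TrivialKernel {n} bs = mk⇔ to from
      where
      to : Independent n (List.map generator bs) → TrivialKernel (slabs n bs)
      to ind x Ax≡0 with ps , m ← vector⇒Matches bs x = Matches-zero⁻ m (ind ps (Matches⇒Bounded m) λ i i<n →
        trans (cong (comb (List.map generator bs) ps) (sym (trans (cong toℕ (Finₚ.opposite-involutive (fromℕ< i<n))) (Finₚ.toℕ-fromℕ< i<n))))
              (trans (sym (slabs-comb m (opposite (fromℕ< i<n)))) (Ax≡0 _)))
      from : TrivialKernel (slabs n bs) → Independent n (List.map generator bs)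
      from tk ps bds comb≡0 with x , m ← Bounded⇒Matches bs bds =
        Matches-zero⁺ m (tk x λ r → trans (slabs-comb m r) (comb≡0 _ (Finₚ.toℕ<n (opposite r))))

  TrivialKernel-cast : ∀ {n m} (eq : m ≡ n) (A : Matrix Carrier n m) →
                       TrivialKernel (λ r k → A r (cast (sym eq) k)) ⇔ TrivialKernel A
  TrivialKernel-cast refl A = mk⇔
    (TrivialKernel-cong _ _ λ r k → cong (A r) (Finₚ.cast-is-id refl k))
    (TrivialKernel-cong _ _ λ r k → cong (A r) (sym (Finₚ.cast-is-id refl k)))

  TrivialKernel? : ∀ {n m} → m ≡ n → (A : Matrix Carrier n m) → Dec (TrivialKernel A)
  TrivialKernel? refl A = map′ (det≢0⇒TrivialKernel A) (TrivialKernel⇒det≢0 A) (¬? (det A ≟ 0#))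

  -- The definition quantifies over all coefficient sequences; for a square matrix the question
  -- becomes whether a determinant vanishes.
  Independent? : ∀ n gs → totalSize gs ≡ n → Dec (Independent n gs)
  Independent? n gs size = subst (Dec ∘ Independent n) (Listₚ.map-id gs) (map′ from to (TrivialKernel? size (slabs n gs)))
    where
    open Slabs id
    open Equivalence (Independent⇔TrivialKernel {n} gs)

  tailOf : Generator → Generator
  tailOf (v , g) = v , tl g

  -- The constant coefficient of every combination is 0 anyway, which leaves `n` linear conditions
  -- on more than `n` unknowns.
  heads-zero⇒¬Independent : ∀ {n gs} → All (λ (v , g) → g 0 ≡ 0#) gs → n < totalSize gs → ¬ Independent (suc n) gs
  heads-zero⇒¬Independent {n} {gs} heads n<size ind =
    let open Slabs tailOf in
    wide⇒¬TrivialKernel n<size (slabs n gs) (Equivalence.to (Independent⇔TrivialKernel gs) λ ps bs comb≡0 → ind ps (bounded gs bs)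
        λ { zero    _         → at-zero heads ps
          ; (suc i) (s≤s i<n) → trans (at-suc heads ps i) (comb≡0 i i<n) })
    where
    bounded : ∀ gs {ps} → Pointwise Bounded (List.map tailOf gs) ps → Pointwise Bounded gs ps
    bounded []       []       = []
    bounded (_ ∷ gs) (b ∷ bs) = b ∷ bounded gs bs
    at-zero : ∀ {gs} → All (λ (v , g) → g 0 ≡ 0#) gs → ∀ ps → comb gs ps 0 ≡ 0#
    at-zero []       ps       = refl
    at-zero (_ ∷ _)  []       = refl
    at-zero (h ∷ hs) (p ∷ ps) = trans (cong₂ _+_ (trans (cong (p 0 *_) h) (zeroʳ _)) (at-zero hs ps)) (+-identityˡ 0#)
    at-suc : ∀ {gs} → All (λ (v , g) → g 0 ≡ 0#) gs → ∀ ps i → comb gs ps (suc i) ≡ comb (List.map tailOf gs) ps i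
    at-suc []       ps       i = refl
    at-suc (_ ∷ _)  []       i = refl
    at-suc (h ∷ hs) (p ∷ ps) i = cong₂ _+_ (⋆-tlʳ p h i) (at-suc hs ps i)

-- Sums and indicators with rational values.

open import Data.Rational.Base using (_/_; _-_; _*_)
open ℚSolver using (solve; _:=_; _:+_; _:*_; _:-_; con)
module ℚΣ = SemiringSum (CommutativeRing.semiring ℚₚ.+-*-commutativeRing)

module RationalSums where
  open import Data.Rational.Base using (_+_)

  /-cross-cong : ∀ a b m n .{{_ : NonZero m}} .{{_ : NonZero n}} → a ℕ.* n ≡ b ℕ.* m → pos a / m ≡ pos b / n
  /-cross-cong a b (suc m) (suc n) eq = ℚₚ.fromℚᵘ-cong {mkℚᵘ (pos a) m} {mkℚᵘ (pos b) n} (*≡* (begin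
    pos a ℤ.* pos (suc n)    ≡⟨ ℤₚ.pos-* a (suc n) ⟨
    pos (a ℕ.* suc n)    ≡⟨ cong pos eq ⟩
    pos (b ℕ.* suc m)    ≡⟨ ℤₚ.pos-* b (suc m) ⟩
    pos b ℤ.* pos (suc m)    ∎))
    where
    open ≡-Reasoning

  /-homo-* : ∀ a b m n .{{_ : NonZero m}} .{{_ : NonZero n}} .{{_ : NonZero (m ℕ.* n)}} →
         (pos a / m) * (pos b / n) ≡ pos (a ℕ.* b) / (m ℕ.* n)
  /-homo-* a b (suc m) (suc n) = ℚₚ.toℚᵘ-injective (begin
    toℚᵘ (fromℚᵘ x * fromℚᵘ y)             ≈⟨ ℚₚ.toℚᵘ-homo-* (fromℚᵘ x) (fromℚᵘ y) ⟩
    toℚᵘ (fromℚᵘ x) ℚᵘ.* toℚᵘ (fromℚᵘ y)   ≈⟨ ℚᵘₚ.*-cong (ℚₚ.toℚᵘ-fromℚᵘ x) (ℚₚ.toℚᵘ-fromℚᵘ y) ⟩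
    x ℚᵘ.* y                               ≡⟨ cong (λ z → mkℚᵘ z _) (ℤₚ.pos-* a b) ⟨
    mkℚᵘ (pos (a ℕ.* b)) _                   ≈⟨ ℚₚ.toℚᵘ-fromℚᵘ (mkℚᵘ (pos (a ℕ.* b)) _) ⟨
    toℚᵘ (pos (a ℕ.* b) / (suc m ℕ.* suc n)) ∎)
    where
    open ℚᵘₚ.≃-Reasoning
    x = mkℚᵘ (pos a) m
    y = mkℚᵘ (pos b) n

  /1-homo-+ : ∀ a b → pos a / 1 + pos b / 1 ≡ pos (a ℕ.+ b) / 1
  /1-homo-+ a b = ℚₚ.toℚᵘ-injective (begin
    toℚᵘ (fromℚᵘ x + fromℚᵘ y)             ≈⟨ ℚₚ.toℚᵘ-homo-+ (fromℚᵘ x) (fromℚᵘ y) ⟩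
    toℚᵘ (fromℚᵘ x) ℚᵘ.+ toℚᵘ (fromℚᵘ y)   ≈⟨ ℚᵘₚ.+-cong (ℚₚ.toℚᵘ-fromℚᵘ x) (ℚₚ.toℚᵘ-fromℚᵘ y) ⟩
    x ℚᵘ.+ y                               ≡⟨ cong (λ z → mkℚᵘ z 0) (cong₂ ℤ._+_ (ℤₚ.*-identityʳ (pos a)) (ℤₚ.*-identityʳ (pos b))) ⟩
    mkℚᵘ (pos (a ℕ.+ b)) 0                   ≈⟨ ℚₚ.toℚᵘ-fromℚᵘ (mkℚᵘ (pos (a ℕ.+ b)) 0) ⟨
    toℚᵘ (pos (a ℕ.+ b) / 1)                 ∎)
    where
    open ℚᵘₚ.≃-Reasoning
    x = mkℚᵘ (pos a) 0
    y = mkℚᵘ (pos b) 0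

  sum-const : ∀ n x → ℚΣ.sum {n} (λ _ → x) ≡ (pos n / 1) * x
  sum-const zero    x = sym (ℚₚ.*-zeroˡ x)
  sum-const (suc n) x = begin
    x + ℚΣ.sum {n} (λ _ → x)    ≡⟨ cong (x +_) (sum-const n x) ⟩
    x + (pos n / 1) * x           ≡⟨ solve 2 (λ x y → x :+ y :* x := (con 1ℚ :+ y) :* x) refl x (pos n / 1) ⟩
    (1ℚ + pos n / 1) * x          ≡⟨ cong (_* x) (/1-homo-+ 1 n) ⟩
    (pos (suc n) / 1) * x           ∎
    where open ≡-Reasoning

  indicator : ∀ {p} {P : Set p} → Dec P → ℚ
  indicator P? = if does P? then 1ℚ else 0ℚ

  indicator-yes : ∀ {p} {P : Set p} (P? : Dec P) → P → indicator P? ≡ 1ℚ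
  indicator-yes P? p = cong (if_then 1ℚ else 0ℚ) (dec-true P? p)

  indicator-no : ∀ {p} {P : Set p} (P? : Dec P) → ¬ P → indicator P? ≡ 0ℚ
  indicator-no P? ¬p = cong (if_then 1ℚ else 0ℚ) (dec-false P? ¬p)

  sumᴸ : ∀ {a} {A : Set a} → List A → (A → ℚ) → ℚ
  sumᴸ []       f = 0ℚ
  sumᴸ (x ∷ xs) f = f x + sumᴸ xs f

  sumᴸ-++ : ∀ {a} {A : Set a} (xs : List A) {ys} f → sumᴸ (xs ++ ys) f ≡ sumᴸ xs f + sumᴸ ys f
  sumᴸ-++ []       f = sym (ℚₚ.+-identityˡ _)
  sumᴸ-++ (x ∷ xs) f = trans (cong (f x +_) (sumᴸ-++ xs f)) (sym (ℚₚ.+-assoc (f x) _ _))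

  sumᴸ-map : ∀ {a b} {A : Set a} {B : Set b} (g : A → B) xs f → sumᴸ (List.map g xs) f ≡ sumᴸ xs (f ∘ g)
  sumᴸ-map g []       f = refl
  sumᴸ-map g (x ∷ xs) f = cong (f (g x) +_) (sumᴸ-map g xs f)

  sumᴸ-cartesianProductWith : ∀ {a b c} {A : Set a} {B : Set b} {C : Set c} (g : A → B → C) xs ys f →
    sumᴸ (cartesianProductWith g xs ys) f ≡ sumᴸ xs (λ x → sumᴸ ys (f ∘ g x))
  sumᴸ-cartesianProductWith g []       ys f = refl
  sumᴸ-cartesianProductWith g (x ∷ xs) ys f = trans (sumᴸ-++ (List.map (g x) ys) f)
    (cong₂ _+_ (sumᴸ-map (g x) ys f) (sumᴸ-cartesianProductWith g xs ys f))

  sumᴸ-tabulate : ∀ {a} {A : Set a} {n} (g : Fin n → A) f → sumᴸ (List.tabulate g) f ≡ ℚΣ.sum (f ∘ g)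
  sumᴸ-tabulate {n = zero}  g f = refl
  sumᴸ-tabulate {n = suc n} g f = cong (f (g zero) +_) (sumᴸ-tabulate (g ∘ suc) f)

  length-filter : ∀ {a p} {A : Set a} {P : Pred A p} (P? : Decidable P) xs →
                  pos (length (filter P? xs)) / 1 ≡ sumᴸ xs (indicator ∘ P?)
  length-filter P? []       = refl
  length-filter P? (x ∷ xs) with does (P? x)
  ... | true  = trans (sym (/1-homo-+ 1 (length (filter P? xs)))) (cong (1ℚ +_) (length-filter P? xs))
  ... | false = trans (length-filter P? xs) (sym (ℚₚ.+-identityˡ _))

open RationalSums

-- Averages over the field.

module Average {c} (F : FiniteField c) where
  open import Data.Rational.Base using (_+_)
  open FiniteField F using (Carrier; 0#; q; _/q^_; _≟_; enumeration; q-nonZero) renaming (_+_ to _+ᶠ_; -_ to -ᶠ_)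
  open FieldAlgebra F using () renaming (+-assoc to +ᶠ-assoc; +-identityʳ to +ᶠ-identityʳ; -‿inverseʳ to -ᶠ-inverseʳ; +-comm to +ᶠ-comm)
  open Inverse enumeration using () renaming (to to element; from to index; strictlyInverseˡ to element-index; strictlyInverseʳ to index-element)

  1/q : ℚ
  1/q = 1 /q^ 1

  /q^-suc : ∀ a n → a /q^ suc n ≡ 1/q * (a /q^ n)
  /q^-suc a n = sym (trans (/-homo-* 1 a (q ^ 1) (q ^ n) {{ℕₚ.m^n≢0 q 1}} {{ℕₚ.m^n≢0 q n}} {{nz}})
    (/-cross-cong (1 ℕ.* a) a (q ^ 1 ℕ.* q ^ n) (q ^ suc n) {{nz}} {{ℕₚ.m^n≢0 q (suc n)}}
      (cong₂ ℕ._*_ (ℕₚ.*-identityˡ a) (cong (ℕ._* q ^ n) (sym (ℕₚ.*-identityʳ q))))))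
    where
    nz : NonZero (q ^ 1 ℕ.* q ^ n)
    nz = ℕₚ.m*n≢0 (q ^ 1) (q ^ n) {{ℕₚ.m^n≢0 q 1}} {{ℕₚ.m^n≢0 q n}}

  q*1/q : (pos q / 1) * 1/q ≡ 1ℚ
  q*1/q = trans (/-homo-* q 1 1 (q ^ 1) {{_}} {{ℕₚ.m^n≢0 q 1}} {{nz}})
    (/-cross-cong (q ℕ.* 1) 1 (1 ℕ.* q ^ 1) 1 {{nz}} (trans (ℕₚ.*-identityʳ _) (trans (sym (ℕₚ.*-assoc q 1 1)) (trans (ℕₚ.*-identityʳ (q ℕ.* 1)) (sym (trans (ℕₚ.*-identityˡ _) (ℕₚ.*-identityˡ _)))))))
    where
    nz : NonZero (1 ℕ.* q ^ 1)
    nz = ℕₚ.m*n≢0 1 (q ^ 1) {{_}} {{ℕₚ.m^n≢0 q 1}}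

  avg : (Carrier → ℚ) → ℚ
  avg f = 1/q * ℚΣ.sum (λ i → f (element i))

  avg-cong : ∀ {f g} → (∀ a → f a ≡ g a) → avg f ≡ avg g
  avg-cong f≗g = cong (1/q *_) (ℚΣ.sum-cong-≗ λ i → f≗g (element i))

  avg-const : ∀ x → avg (λ _ → x) ≡ x
  avg-const x = begin
    1/q * ℚΣ.sum {q} (λ _ → x)  ≡⟨ cong (1/q *_) (sum-const q x) ⟩
    1/q * ((pos q / 1) * x)       ≡⟨ solve 3 (λ a b x → a :* (b :* x) := b :* a :* x) refl 1/q (pos q / 1) x ⟩
    (pos q / 1) * 1/q * x         ≡⟨ cong (_* x) q*1/q ⟩
    1ℚ * x                      ≡⟨ ℚₚ.*-identityˡ x ⟩
    x                           ∎
    where open ≡-Reasoning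

  avg-* : ∀ k f → avg (λ a → k * f a) ≡ k * avg f
  avg-* k f = trans (cong (1/q *_) (sym (ℚΣ.*-distribˡ-sum k (λ i → f (element i)))))
                    (solve 3 (λ r k s → r :* (k :* s) := k :* (r :* s)) refl 1/q k _)

  avg-+ : ∀ f g → avg (λ a → f a + g a) ≡ avg f + avg g
  avg-+ f g = trans (cong (1/q *_) (ℚΣ.∑-distrib-+ (λ i → f (element i)) (λ i → g (element i)))) (ℚₚ.*-distribˡ-+ 1/q _ _)

  avg-affine : ∀ x k f → avg (λ a → x + k * f a) ≡ x + k * avg f
  avg-affine x k f = trans (avg-+ (λ _ → x) (λ a → k * f a)) (cong₂ _+_ (avg-const x) (avg-* k f))

  avg-comm : ∀ (f : Carrier → Carrier → ℚ) → avg (λ a → avg (f a)) ≡ avg (λ b → avg (λ a → f a b))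
  avg-comm f = cong (1/q *_) (begin
    ℚΣ.sum (λ i → 1/q * ℚΣ.sum (λ j → f (element i) (element j)))   ≡⟨ ℚΣ.*-distribˡ-sum 1/q (λ i → ℚΣ.sum λ j → f (element i) (element j)) ⟨
    1/q * ℚΣ.sum (λ i → ℚΣ.sum (λ j → f (element i) (element j)))   ≡⟨ cong (1/q *_) (ℚΣ.∑-comm (λ i j → f (element i) (element j))) ⟩
    1/q * ℚΣ.sum (λ j → ℚΣ.sum (λ i → f (element i) (element j)))   ≡⟨ ℚΣ.*-distribˡ-sum 1/q (λ j → ℚΣ.sum λ i → f (element i) (element j)) ⟩
    ℚΣ.sum (λ j → 1/q * ℚΣ.sum (λ i → f (element i) (element j)))   ∎)
    where open ≡-Reasoning

  +ᶠ-cancel : ∀ a b → a +ᶠ b +ᶠ -ᶠ b ≡ a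
  +ᶠ-cancel a b = trans (+ᶠ-assoc a b (-ᶠ b)) (trans (cong (a +ᶠ_) (-ᶠ-inverseʳ b)) (+ᶠ-identityʳ a))

  translation : Carrier → FinPerm.Permutation q q
  translation b = FinPerm.permutation (λ i → index (element i +ᶠ b)) (λ i → index (element i +ᶠ -ᶠ b))
    (λ i → trans (cong (λ a → index (a +ᶠ b)) (element-index _)) (trans (cong index (trans (swap _ (-ᶠ b) b) (+ᶠ-cancel _ b))) (index-element _)))
    (λ i → trans (cong (λ a → index (a +ᶠ -ᶠ b)) (element-index _)) (trans (cong index (+ᶠ-cancel _ b)) (index-element _)))
    where
    swap : ∀ a b c → a +ᶠ b +ᶠ c ≡ a +ᶠ c +ᶠ b
    swap a b c = trans (+ᶠ-assoc a b c) (trans (cong (a +ᶠ_) (+ᶠ-comm b c)) (sym (+ᶠ-assoc a c b)))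

  avg-shift : ∀ b f → avg (λ a → f (a +ᶠ b)) ≡ avg f
  avg-shift b f = cong (1/q *_) (trans (ℚΣ.sum-cong-≗ λ i → cong f (sym (element-index (element i +ᶠ b))))
                                       (sym (ℚΣ.sum-permute (λ i → f (element i)) (translation b))))

  isZero : Carrier → ℚ
  isZero a = indicator (a ≟ 0#)

  avg-isZero : avg isZero ≡ 1/q
  avg-isZero = trans (cong (1/q *_) (single (index 0#) (indicator-yes (_ ≟ 0#) (element-index 0#))
      λ j j≢ → indicator-no (_ ≟ 0#) λ eⱼ≡0 → j≢ (trans (sym (index-element j)) (cong index eⱼ≡0)))) (ℚₚ.*-identityʳ 1/q)
    where
    single : ∀ {n} {f : Fin n → ℚ} i → f i ≡ 1ℚ → (∀ j → j ≢ i → f j ≡ 0ℚ) → ℚΣ.sum f ≡ 1ℚ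
    single {suc n} {f} zero    one zeros = trans (cong₂ _+_ one (trans (ℚΣ.sum-cong-≗ {n} {f ∘ suc} {λ _ → 0ℚ} λ j → zeros (suc j) (λ ())) (ℚΣ.sum-replicate-zero n))) refl
    single {suc n} {f} (suc i) one zeros = trans (cong₂ _+_ (zeros zero (λ ())) (single i one (λ j j≢i → zeros (suc j) (λ { refl → j≢i refl })))) refl

-- Random generators and their independence.

module RandomGenerators {c} (F : FiniteField c) where
  open import Data.Rational.Base using (_+_)
  open FiniteField F using (Carrier; 0#; _≟_) renaming (_+_ to _+ᶠ_; _*_ to _*ᶠ_)
  open FieldAlgebra F using (zeroˡ)
  open Generators F
  open Average F
  open OverField F using (γ; _/q^_)

  -- The average of H over all sequences that agree with α from index m on.
  rand : ℕ → Seq → (Seq → ℚ) → ℚ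
  rand zero    α H = H α
  rand (suc m) α H = avg λ a → rand m (tl α) λ s → H (a ∷ˢ s)

  Respects≗ : (Seq → ℚ) → Set c
  Respects≗ H = ∀ s s′ → s ≗ s′ → H s ≡ H s′

  Respects≗-∷ˢ : ∀ {H} a → Respects≗ H → Respects≗ (λ s → H (a ∷ˢ s))
  Respects≗-∷ˢ a resp s s′ s≗s′ = resp (a ∷ˢ s) (a ∷ˢ s′) λ { zero → refl ; (suc i) → s≗s′ i }

  rand-cong : ∀ m α {H H′} → (∀ s → (∀ i → m ≤ i → s i ≡ α i) → H s ≡ H′ s) → rand m α H ≡ rand m α H′
  rand-cong zero    α H≗H′ = H≗H′ α λ _ _ → refl
  rand-cong (suc m) α H≗H′ = avg-cong λ a → rand-cong m (tl α) λ s eq →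
    H≗H′ (a ∷ˢ s) λ { (suc i) (s≤s m≤i) → eq i m≤i }

  rand-base : ∀ m (α β : Seq) {H} → Respects≗ H → (∀ i → m ≤ i → α i ≡ β i) → rand m α H ≡ rand m β H
  rand-base zero    α β resp α≗β = resp α β λ i → α≗β i z≤n
  rand-base (suc m) α β resp α≗β = avg-cong λ a → rand-base m (tl α) (tl β) (Respects≗-∷ˢ a resp) λ i m≤i → α≗β (suc i) (s≤s m≤i)

  infixl 6 _⊕_
  _⊕_ : Seq → Seq → Seq
  (α ⊕ β) i = α i +ᶠ β i

  -- The uniform coefficients absorb the translation by `avg-shift`; the others carry it into the
  -- base.
  rand-shift : ∀ m α β {H} → Respects≗ H → rand m α (λ s → H (s ⊕ β)) ≡ rand m (α ⊕ β) H
  rand-shift zero    α β {H} resp = refl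
  rand-shift (suc m) α β {H} resp = begin
    avg (λ a → rand m (tl α) λ s → H ((a ∷ˢ s) ⊕ β))
      ≡⟨ avg-cong (λ a → rand-cong m (tl α) λ s _ → resp ((a ∷ˢ s) ⊕ β) ((a +ᶠ β 0) ∷ˢ s ⊕ tl β) λ { zero → refl ; (suc i) → refl }) ⟩
    avg (λ a → rand m (tl α) λ s → H ((a +ᶠ β 0) ∷ˢ s ⊕ tl β))
      ≡⟨ avg-cong (λ a → rand-shift m (tl α) (tl β) (Respects≗-∷ˢ (a +ᶠ β 0) resp)) ⟩
    avg (λ a → rand m (tl α ⊕ tl β) λ s → H ((a +ᶠ β 0) ∷ˢ s))
      ≡⟨ avg-shift (β 0) (λ a → rand m (tl α ⊕ tl β) λ s → H (a ∷ˢ s)) ⟩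
    avg (λ a → rand m (tl α ⊕ tl β) λ s → H (a ∷ˢ s)) ∎
    where open ≡-Reasoning

  rand-const : ∀ m α x → rand m α (λ _ → x) ≡ x
  rand-const zero    α x = refl
  rand-const (suc m) α x = trans (avg-cong λ _ → rand-const m (tl α) x) (avg-const x)

  -- (v , u₀ , α) describes a random generator (v , u₀ ∷ˢ s) for a block with n rows and v columns: the entries
  -- s 0, …, s (n - v - 1) are random and the others, which form the attic, are those of α; u₀ is random if absent.
  Spec : Set c
  Spec = ℕ × Maybe Carrier × Seq

  draw : ℕ → Spec → (Generator → ℚ) → ℚ
  draw n (v , just a  , α) H = rand (n ∸ v) α λ s → H (v , a ∷ˢ s)
  draw n (v , nothing , α) H = avg λ a → draw n (v , just a , α) H

  draws : ℕ → List Spec → (List Generator → ℚ) → ℚ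
  draws n []       f = f []
  draws n (b ∷ bs) f = draw n b λ g → draws n bs λ gs → f (g ∷ gs)

  -- Fubini, bootstrapped: an operator that commutes with `avg` commutes with every draw. Applied to
  -- `avg` itself, this shows that draws commute with `avg`, and hence with each other.
  record Averaging {X : Set c} (E : (X → ℚ) → ℚ) : Set c where
    field
      cong-≗   : ∀ {f g} → (∀ x → f x ≡ g x) → E f ≡ E g
      comm-avg : ∀ (f : X → Carrier → ℚ) → E (λ x → avg (f x)) ≡ avg (λ a → E λ x → f x a)

    comm-rand : ∀ m α (f : X → Seq → ℚ) → E (λ x → rand m α (f x)) ≡ rand m α (λ s → E λ x → f x s)
    comm-rand zero    α f = refl
    comm-rand (suc m) α f = trans (comm-avg λ x a → rand m (tl α) λ s → f x (a ∷ˢ s))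
                                  (avg-cong λ a → comm-rand m (tl α) λ x s → f x (a ∷ˢ s))

    comm-draw : ∀ n b (f : X → Generator → ℚ) → E (λ x → draw n b (f x)) ≡ draw n b (λ g → E λ x → f x g)
    comm-draw n (v , just a  , α) f = comm-rand (n ∸ v) α λ x s → f x (v , a ∷ˢ s)
    comm-draw n (v , nothing , α) f = trans (comm-avg λ x a → draw n (v , just a , α) (f x))
                                            (avg-cong λ a → comm-draw n (v , just a , α) f)

  avg-averaging : Averaging avg
  avg-averaging = record { cong-≗ = avg-cong ; comm-avg = avg-comm }

  draw-cong : ∀ n b {H H′} → (∀ g → H g ≡ H′ g) → draw n b H ≡ draw n b H′
  draw-cong n (v , just a  , α) eq = rand-cong (n ∸ v) α λ s _ → eq _
  draw-cong n (v , nothing , α) eq = avg-cong λ a → draw-cong n (v , just a , α) eq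

  draw-averaging : ∀ n b → Averaging (draw n b)
  draw-averaging n b = record
    { cong-≗   = draw-cong n b
    ; comm-avg = λ f → sym (Averaging.comm-draw avg-averaging n b λ a g → f g a) }

  -- What every draw satisfies for certain; it suffices to tell whether the series can be reduced
  -- and whether all constant terms vanish.
  Fits : Spec → Generator → Set c
  Fits (v , u₀ , _) (w , g) = w ≡ v × (∀ a → u₀ ≡ just a → g 0 ≡ a)

  draw-cong-Fits : ∀ n b {H H′} → (∀ g → Fits b g → H g ≡ H′ g) → draw n b H ≡ draw n b H′
  draw-cong-Fits n (v , just a  , α) eq = rand-cong (n ∸ v) α λ s _ → eq _ (refl , λ { _ refl → refl })
  draw-cong-Fits n (v , nothing , α) eq = avg-cong λ a → draw-cong-Fits n (v , just a , α) λ g (p , _) → eq g (p , λ _ ())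

  draws-cong-Fits : ∀ n bs {f f′} → (∀ gs → Pointwise Fits bs gs → f gs ≡ f′ gs) → draws n bs f ≡ draws n bs f′
  draws-cong-Fits n []       eq = eq [] []
  draws-cong-Fits n (b ∷ bs) eq = draw-cong-Fits n b λ g fit → draws-cong-Fits n bs λ gs fits → eq (g ∷ gs) (fit ∷ fits)

  draws-cong : ∀ n bs {f f′} → (∀ gs → f gs ≡ f′ gs) → draws n bs f ≡ draws n bs f′
  draws-cong n bs eq = draws-cong-Fits n bs λ gs _ → eq gs

  draws-const : ∀ n bs x → draws n bs (λ _ → x) ≡ x
  draws-const n []       x = refl
  draws-const n (b ∷ bs) x = trans (draw-cong n b λ _ → draws-const n bs x) (draw-const b)
    where
    draw-const : ∀ b → draw n b (λ _ → x) ≡ x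
    draw-const (v , just a  , α) = rand-const (n ∸ v) α x
    draw-const (v , nothing , α) = trans (avg-cong λ a → draw-const (v , just a , α)) (avg-const x)

  draws-↭ : ∀ n {bs bs′} → bs ↭ bs′ → ∀ {f} → (∀ {gs gs′} → gs ↭ gs′ → f gs ≡ f gs′) → draws n bs f ≡ draws n bs′ f
  draws-↭ n Perm.refl inv = refl
  draws-↭ n (Perm.prep b σ) inv = draw-cong n b λ g → draws-↭ n σ (inv ∘ Perm.prep g)
  draws-↭ n {x ∷ y ∷ bs} {_ ∷ _ ∷ bs′} (Perm.swap x y σ) {f} inv = begin
    draw n x (λ g → draw n y λ h → draws n bs λ gs → f (g ∷ h ∷ gs))
      ≡⟨ Averaging.comm-draw (draw-averaging n x) n y (λ g h → draws n bs λ gs → f (g ∷ h ∷ gs)) ⟩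
    draw n y (λ h → draw n x λ g → draws n bs λ gs → f (g ∷ h ∷ gs))
      ≡⟨ draw-cong n y (λ h → draw-cong n x λ g → trans
           (draws-↭ n σ (inv ∘ Perm.prep g ∘ Perm.prep h))
           (draws-cong n bs′ λ gs → inv (Perm.swap g h Perm.refl))) ⟩
    draw n y (λ h → draw n x λ g → draws n bs′ λ gs → f (h ∷ g ∷ gs)) ∎
    where open ≡-Reasoning
  draws-↭ n (Perm.trans σ τ) inv = trans (draws-↭ n σ inv) (draws-↭ n τ inv)

  -- The size condition makes the property decidable for every list, as `Independent?` goes through
  -- a square matrix.
  Nonsingular : ℕ → List Generator → Set c
  Nonsingular n gs = totalSize gs ≡ n × Independent n gs

  nonsingular? : ∀ n gs → Dec (Nonsingular n gs)
  nonsingular? n gs with totalSize gs ℕₚ.≟ n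
  ... | no  size≢ = no (size≢ ∘ proj₁)
  ... | yes size  with Independent? n gs size
  ...   | yes ind = yes (size , ind)
  ...   | no ¬ind = no (¬ind ∘ proj₂)

  χ : ℕ → List Generator → ℚ
  χ n gs = indicator (nonsingular? n gs)

  χ-yes : ∀ n gs → Nonsingular n gs → χ n gs ≡ 1ℚ
  χ-yes n gs = indicator-yes (nonsingular? n gs)

  χ-no : ∀ n gs → ¬ Nonsingular n gs → χ n gs ≡ 0ℚ
  χ-no n gs = indicator-no (nonsingular? n gs)

  χ-⇔ : ∀ n gs n′ gs′ → Nonsingular n gs ⇔ Nonsingular n′ gs′ → χ n gs ≡ χ n′ gs′
  χ-⇔ n gs n′ gs′ equiv with nonsingular? n gs
  ... | yes ns = sym (χ-yes n′ gs′ (Equivalence.to equiv ns))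
  ... | no ¬ns = sym (χ-no n′ gs′ (¬ns ∘ Equivalence.from equiv))

  χ-↭ : ∀ n {gs gs′} → gs ↭ gs′ → χ n gs ≡ χ n gs′
  χ-↭ n {gs} {gs′} σ = χ-⇔ n gs n gs′ (mk⇔ (to σ) (to (↭-sym σ)))
    where
    to : ∀ {gs gs′} → gs ↭ gs′ → Nonsingular n gs → Nonsingular n gs′
    to σ (size , ind) = trans (ListActionₚ.sum-↭ (Permₚ.map⁺ proj₁ (↭-sym σ))) size , Independent-↭ σ ind

  totalSize-cong : ∀ {gs gs′} → Pointwise _≈ᵍ_ gs gs′ → totalSize gs ≡ totalSize gs′
  totalSize-cong []              = refl
  totalSize-cong ((p , _) ∷ eqs) = cong₂ ℕ._+_ p (totalSize-cong eqs)

  ≈ᵍ-sym : ∀ {gs gs′} → Pointwise _≈ᵍ_ gs gs′ → Pointwise _≈ᵍ_ gs′ gs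
  ≈ᵍ-sym []              = []
  ≈ᵍ-sym ((p , q) ∷ eqs) = (sym p , λ i → sym (q i)) ∷ ≈ᵍ-sym eqs

  ≈ᵍ-refl : ∀ {gs} → Pointwise _≈ᵍ_ gs gs
  ≈ᵍ-refl {[]}     = []
  ≈ᵍ-refl {g ∷ gs} = (refl , λ _ → refl) ∷ ≈ᵍ-refl

  Respects≈ᵍ : (List Generator → ℚ) → Set c
  Respects≈ᵍ f = ∀ {gs gs′} → Pointwise _≈ᵍ_ gs gs′ → f gs ≡ f gs′

  χ-respects : ∀ n → Respects≈ᵍ (χ n)
  χ-respects n {gs} {gs′} eqs = χ-⇔ n gs n gs′ (mk⇔ (to eqs) (to (≈ᵍ-sym eqs)))
    where
    to : ∀ {gs gs′} → Pointwise _≈ᵍ_ gs gs′ → Nonsingular n gs → Nonsingular n gs′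
    to eqs (size , ind) = trans (sym (totalSize-cong eqs)) size , Independent-cong eqs ind

  χ-drop : ∀ n g gs → χ n ((0 , g) ∷ gs) ≡ χ n gs
  χ-drop n g gs = χ-⇔ n ((0 , g) ∷ gs) n gs (mk⇔ (λ (size , ind) → size , Equivalence.to (Independent-drop {n} {g} {gs}) ind)
                    (λ (size , ind) → size , Equivalence.from (Independent-drop {n} {g} {gs}) ind))

  totalSize-reduce : ∀ t gs → totalSize (List.map (reduce t) gs) ≡ totalSize gs
  totalSize-reduce t []             = refl
  totalSize-reduce t ((v , _) ∷ gs) = cong (v ℕ.+_) (totalSize-reduce t gs)

  χ-reduce : ∀ n w t gs → t 0 ≢ 0# → All (λ (v , g) → v ≤ suc w ⊎ g 0 ≡ 0#) gs →
             χ (suc n) ((suc w , t) ∷ gs) ≡ χ n ((w , t) ∷ List.map (reduce t) gs)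
  χ-reduce n w t gs t₀≢0 rs = χ-⇔ (suc n) ((suc w , t) ∷ gs) n ((w , t) ∷ List.map (reduce t) gs) (mk⇔
    (λ (size , ind) → trans (cong (w ℕ.+_) (totalSize-reduce t gs)) (ℕₚ.suc-injective size) , Equivalence.to (Independent-reduce {t} t₀≢0 rs) ind)
    (λ (size , ind) → cong suc (trans (cong (w ℕ.+_) (sym (totalSize-reduce t gs))) size) , Equivalence.from (Independent-reduce {t} t₀≢0 rs) ind))

  -- The effect of one pivot step on the distribution.

  FixedSpec : Set c
  FixedSpec = ℕ × Carrier × Seq

  fix : FixedSpec → Spec
  fix (v , a , α) = v , just a , α

  -- The distribution of a reduced block. Its constant term is a translate of the former u₁, hence
  -- uniform; its attic is that of g + κ t, and the shift of the index is the division by x.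
  next : FixedSpec → FixedSpec → Spec
  next (_ , a , α) (v , b , β) = v , nothing , λ i → β (suc i) +ᶠ multiplier a b *ᶠ α (suc i)

  -- If v ≤ w + 1, the constant coefficients of the block start at n + 1 - v ≥ n - w, where the
  -- pivot too is given by `α`; before that, κ s only translates uniform coefficients. If b = 0,
  -- then κ = 0.
  draws-next : ∀ {n w a α} → a ≢ 0# → ∀ s → (∀ i → n ∸ w ≤ i → s i ≡ α i) → ∀ {fs} →
    All (λ (v , b , _) → v ≤ suc w ⊎ b ≡ 0#) fs → All (λ (v , _) → v ≤ n) fs → ∀ {f} → Respects≈ᵍ f →
    draws (suc n) (List.map fix fs) (λ gs → f (List.map (reduce (a ∷ˢ s)) gs)) ≡ draws n (List.map (next (suc w , a , α)) fs) f
  draws-next a≢0 s s≗α [] [] resp = refl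
  draws-next {n} {w} {a} {α} a≢0 s s≗α {(v , b , β) ∷ fs} (r ∷ rs) (v≤n ∷ vs≤n) {f} resp = begin
    rand (suc n ∸ v) β (λ u → draws (suc n) (List.map fix fs) λ gs → f ((v , u ⊕ κs) ∷ List.map (reduce (a ∷ˢ s)) gs))
      ≡⟨ rand-cong (suc n ∸ v) β (λ u _ → draws-next a≢0 s s≗α rs vs≤n {λ gs → f ((v , u ⊕ κs) ∷ gs)} (resp ∘ ((refl , λ _ → refl) ∷_))) ⟩
    rand (suc n ∸ v) β (λ u → H (u ⊕ κs))
      ≡⟨ rand-shift (suc n ∸ v) β κs H-resp ⟩
    rand (suc n ∸ v) (β ⊕ κs) H
      ≡⟨ rand-base (suc n ∸ v) (β ⊕ κs) (β ⊕ κα) H-resp (λ i i≥ → cong (β i +ᶠ_) (κs≡κα r i i≥)) ⟩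
    rand (suc n ∸ v) (β ⊕ κα) H
      -- As v ≤ n, at least one coefficient of the block is random; the first of them becomes the
      -- new constant term.
      ≡⟨ cong (λ m → rand m (β ⊕ κα) H) (ℕₚ.+-∸-assoc 1 v≤n) ⟩
    draws n (List.map (next (suc w , a , α)) ((v , b , β) ∷ fs)) f ∎
    where
    open ≡-Reasoning
    κ = multiplier a b
    κs κα : Seq
    κs i = κ *ᶠ s i
    κα i = κ *ᶠ α i
    H : Seq → ℚ
    H u = draws n (List.map (next (suc w , a , α)) fs) λ gs → f ((v , u) ∷ gs)
    H-resp : Respects≗ H
    H-resp u u′ u≗u′ = draws-cong n (List.map (next (suc w , a , α)) fs) λ gs → resp ((refl , u≗u′) ∷ ≈ᵍ-refl)
    κs≡κα : v ≤ suc w ⊎ b ≡ 0# → ∀ i → suc n ∸ v ≤ i → κ *ᶠ s i ≡ κ *ᶠ α i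
    κs≡κα (inj₁ v≤) i i≥ = cong (κ *ᶠ_) (s≗α i (ℕₚ.≤-trans (ℕₚ.∸-monoʳ-≤ (suc n) v≤) i≥))
    κs≡κα (inj₂ b≡0) i i≥ = trans (trans (cong (_*ᶠ s i) κ≡0) (zeroˡ _)) (sym (trans (cong (_*ᶠ α i) κ≡0) (zeroˡ _)))
      where κ≡0 = multiplier-zero a≢0 b≡0

  -- The pivot is held fixed while the other blocks are averaged. Their new distribution does not
  -- involve its random coefficients, and these number n - w = (n + 1) - (w + 1), as befits a block
  -- of width w in size n.
  draws-pivot : ∀ {n w a α} → a ≢ 0# → ∀ {fs} →
    All (λ (v , b , _) → v ≤ suc w ⊎ b ≡ 0#) fs → All (λ (v , _) → v ≤ n) fs →
    draws (suc n) (List.map fix ((suc w , a , α) ∷ fs)) (χ (suc n)) ≡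
    rand (n ∸ w) α (λ s → draws n (List.map (next (suc w , a , α)) fs) λ gs → χ n ((w , a ∷ˢ s) ∷ gs))
  draws-pivot {n} {w} {a} {α} a≢0 {fs} rs vs≤n = rand-cong (n ∸ w) α λ s s≗α → trans
    (draws-cong-Fits (suc n) (List.map fix fs) λ gs fits → χ-reduce n w (a ∷ˢ s) gs a≢0 (reducible rs fits))
    (draws-next a≢0 s s≗α rs vs≤n {λ gs → χ n ((w , a ∷ˢ s) ∷ gs)} λ {gs} {gs′} eqs →
      χ-respects n {(w , a ∷ˢ s) ∷ gs} {(w , a ∷ˢ s) ∷ gs′} ((refl , λ _ → refl) ∷ eqs))
    where
    reducible : ∀ {fs gs} → All (λ (v , b , _) → v ≤ suc w ⊎ b ≡ 0#) fs → Pointwise Fits (List.map fix fs) gs →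
                All (λ (v , g) → v ≤ suc w ⊎ g 0 ≡ 0#) gs
    reducible []       []                    = []
    reducible (inj₁ p ∷ rs) ((refl , eq) ∷ fits) = inj₁ p ∷ reducible rs fits
    reducible (inj₂ p ∷ rs) ((refl , eq) ∷ fits) = inj₂ (trans (eq _ refl) p) ∷ reducible rs fits

  -- The nonsingularity probability, by induction on the size.

  size : List Spec → ℕ
  size bs = ListAction.sum (List.map proj₁ bs)

  Wide : Spec → Set
  Wide (v , _) = 1 ≤ v

  headZero : Spec → ℚ
  headZero (_ , just a  , _) = isZero a
  headZero (_ , nothing , _) = 1/q

  -- The probability that all the u₀ vanish; it becomes 0^ℓ/q^i in `allZero-specs`.
  allZero : List Spec → ℚ
  allZero []       = 1ℚ
  allZero (b ∷ bs) = headZero b * allZero bs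

  allZero-↭ : ∀ {bs bs′} → bs ↭ bs′ → allZero bs ≡ allZero bs′
  allZero-↭ Perm.refl         = refl
  allZero-↭ (Perm.prep b σ)   = cong (headZero b *_) (allZero-↭ σ)
  allZero-↭ (Perm.swap b b′ σ) = trans (cong (λ z → headZero b * (headZero b′ * z)) (allZero-↭ σ))
    (solve 3 (λ x y z → x :* (y :* z) := y :* (x :* z)) refl (headZero b) (headZero b′) _)
  allZero-↭ (Perm.trans σ τ)  = trans (allZero-↭ σ) (allZero-↭ τ)

  NonzeroHead : FixedSpec → Set c
  NonzeroHead (_ , a , _) = a ≢ 0#

  Dominates : FixedSpec → FixedSpec → Set c
  Dominates (w , _) (v , b , _) = v ≤ w ⊎ b ≡ 0#

  pivot : ∀ fs → All (λ (_ , a , _) → a ≡ 0#) fs ⊎ ∃₂ λ t fs′ → fs ↭ t ∷ fs′ × NonzeroHead t × All (Dominates t) fs′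
  pivot [] = inj₁ []
  pivot (f@(v , a , _) ∷ fs) with pivot fs | a ≟ 0#
  ... | inj₁ zs | yes a≡0 = inj₁ (a≡0 ∷ zs)
  ... | inj₁ zs | no  a≢0 = inj₂ (f , fs , Perm.refl , a≢0 , All.map inj₂ zs)
  ... | inj₂ (t , fs′ , σ , t≢0 , ds) | yes a≡0 =
    inj₂ (t , f ∷ fs′ , Perm.trans (Perm.prep f σ) (Perm.swap f t Perm.refl) , t≢0 , inj₂ a≡0 ∷ ds)
  ... | inj₂ (t@(w , _) , fs′ , σ , t≢0 , ds) | no a≢0 with v ℕₚ.≤? w
  ...   | yes v≤w = inj₂ (t , f ∷ fs′ , Perm.trans (Perm.prep f σ) (Perm.swap f t Perm.refl) , t≢0 , inj₁ v≤w ∷ ds)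
  -- The new block is wider than the pivot found so far, hence dominates it and everything dominated
  -- by it.
  ...   | no  v≰w = inj₂ (f , fs , Perm.refl , a≢0 ,
      Permₚ.All-resp-↭ (↭-sym σ) (inj₁ w≤v ∷ All.map [ (λ u≤w → inj₁ (ℕₚ.≤-trans u≤w w≤v)) , inj₂ ]′ ds))
    where w≤v = ℕₚ.<⇒≤ (ℕₚ.≰⇒> v≰w)

  width≤size : ∀ fs → All (λ ((v , _) : FixedSpec) → v ≤ size (List.map fix fs)) fs
  width≤size []             = []
  width≤size ((v , _) ∷ fs) = ℕₚ.m≤m+n v _ ∷ All.map (λ w≤ → ℕₚ.≤-trans w≤ (ℕₚ.m≤n+m _ v)) (width≤size fs)

  size-next : ∀ t fs → size (List.map (next t) fs) ≡ size (List.map fix fs)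
  size-next t []             = refl
  size-next t ((v , _) ∷ fs) = cong (v ℕ.+_) (size-next t fs)

  Wide-next : ∀ t fs → All Wide (List.map fix fs) → All Wide (List.map (next t) fs)
  Wide-next t []       []       = []
  Wide-next t (_ ∷ fs) (v ∷ vs) = v ∷ Wide-next t fs vs

  allZero-next : ∀ t fs → allZero (List.map (next t) fs) ≡ 1 /q^ length fs
  allZero-next t []       = refl
  allZero-next t (_ ∷ fs) = trans (cong (1/q *_) (allZero-next t fs)) (sym (/q^-suc 1 (length fs)))

  allZero-zeros : ∀ {fs} → All (λ (_ , a , _) → a ≡ 0#) fs → allZero (List.map fix fs) ≡ 1ℚ
  allZero-zeros []       = refl
  allZero-zeros (z ∷ zs) = cong₂ _*_ (indicator-yes (_ ≟ 0#) z) (allZero-zeros zs)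

  singular-zeros : ∀ {n fs} → All (λ (_ , a , _) → a ≡ 0#) fs → draws (suc n) (List.map fix fs) (χ (suc n)) ≡ 0ℚ
  singular-zeros {n} {fs} zs = trans (draws-cong-Fits (suc n) (List.map fix fs) λ gs fits →
      χ-no (suc n) gs λ (total , ind) → heads-zero⇒¬Independent (heads zs fits) (subst (n <_) (sym total) (ℕₚ.n<1+n n)) ind)
    (draws-const (suc n) (List.map fix fs) 0ℚ)
    where
    heads : ∀ {fs gs} → All (λ (_ , a , _) → a ≡ 0#) fs → Pointwise Fits (List.map fix fs) gs → All (λ (_ , g) → g 0 ≡ 0#) gs
    heads []       []                = []
    heads (z ∷ zs) ((_ , eq) ∷ fits) = trans (eq _ refl) z ∷ heads zs fits

  NonsingularityLaw : ℕ → List Spec → Set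
  NonsingularityLaw n bs = draws n bs (χ n) ≡ γ (length bs) * (1ℚ - allZero bs)

  -- Blocks without columns are excluded because the law counts blocks: by `χ-drop` such a block
  -- would raise the index of `γ` without affecting nonsingularity.
  Full : ℕ → List Spec → Set c
  Full n bs = All Wide bs × size bs ≡ n

  Full-↭ : ∀ {n bs bs′} → bs ↭ bs′ → Full n bs → Full n bs′
  Full-↭ σ (wide , total) = Permₚ.All-resp-↭ σ wide , trans (ListActionₚ.sum-↭ (Permₚ.map⁺ proj₁ (↭-sym σ))) total

  law-↭ : ∀ {n bs bs′} → bs ↭ bs′ → NonsingularityLaw n bs′ → NonsingularityLaw n bs
  law-↭ {n} σ law = trans (draws-↭ n σ (χ-↭ n)) (trans law
    (cong₂ (λ k z → γ k * (1ℚ - z)) (sym (Permₚ.↭-length σ)) (sym (allZero-↭ σ))))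

  x*[1-0*y] : ∀ {z} x y → z ≡ 0ℚ → x ≡ x * (1ℚ - z * y)
  x*[1-0*y] x y refl = sym (trans (cong (λ w → x * (1ℚ - w)) (ℚₚ.*-zeroˡ y)) (ℚₚ.*-identityʳ x))

  -- The induction hypothesis is restricted to positive n because the law fails at size 0: the empty
  -- family is nonsingular, whereas `allZero [] ≡ 1ℚ` makes the right side 0.
  law-pivot : ∀ n → (∀ m → n ≡ suc m → ∀ bs → Full n bs → NonsingularityLaw n bs) →
              ∀ t fs → NonzeroHead t → All (Dominates t) fs → Full (suc n) (List.map fix (t ∷ fs)) →
              NonsingularityLaw (suc n) (List.map fix (t ∷ fs))
  law-pivot n law (suc w , a , α) fs a≢0 ds (_ ∷ wide , total) = trans
    (draws-pivot a≢0 ds (All.map (λ v≤ → ℕₚ.≤-trans v≤ size≤n) (width≤size fs)))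
    (trans (remaining w total′) (x*[1-0*y] _ _ (indicator-no (a ≟ 0#) a≢0)))
    where
    t : FixedSpec
    t = suc w , a , α
    total′ : w ℕ.+ size (List.map fix fs) ≡ n
    total′ = ℕₚ.suc-injective total
    size≤n : size (List.map fix fs) ≤ n
    size≤n = subst (size (List.map fix fs) ≤_) total′ (ℕₚ.m≤n+m _ w)
    rest = List.map (next t) fs
    full : ∀ w → w ℕ.+ size (List.map fix fs) ≡ n → w ℕ.+ size rest ≡ n
    full w total = trans (cong (w ℕ.+_) (size-next t fs)) total
    drop-pivot : ∀ fs → All Wide (List.map fix fs) → size (List.map fix fs) ≡ n →
      draws n (List.map (next t) fs) (χ n) ≡ γ (suc (length (List.map fix fs)))
    -- The pivot was the whole 1 × 1 matrix; the empty family left behind is nonsingular, in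
    -- accordance with γ₁ = 1.
    drop-pivot [] _ refl = χ-yes 0 [] (refl , λ { [] [] _ → [] })
    -- With `fs` visibly nonempty, the defining equation of `γ` turns the law for the k - 1
    -- remaining blocks into γ_k.
    drop-pivot fs@(f ∷ fs′) wide@(s≤s z≤n ∷ _) total = trans
      (law _ (sym total) (List.map (next t) fs) (Wide-next t fs wide , trans (size-next t fs) total))
      (cong₂ (λ k z → γ k * (1ℚ - z)) (lengths fs) (trans (allZero-next t fs) (cong (1 /q^_) (sym (Listₚ.length-map fix fs)))))
      where
      lengths : ∀ fs → length (List.map (next t) fs) ≡ length (List.map fix fs)
      lengths fs = trans (Listₚ.length-map (next t) fs) (sym (Listₚ.length-map fix fs))
    remaining : ∀ w → w ℕ.+ size (List.map fix fs) ≡ n →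
      rand (n ∸ w) α (λ s → draws n rest λ gs → χ n ((w , a ∷ˢ s) ∷ gs)) ≡ γ (suc (length (List.map fix fs)))
    remaining zero total = trans
      (rand-cong n α λ s _ → draws-cong n rest λ gs → χ-drop n (a ∷ˢ s) gs)
      (trans (rand-const n α _) (drop-pivot fs wide total))
    -- The surviving pivot keeps its nonzero u₀, so `allZero` is 0 and the law gives `γ` at the
    -- unchanged number of blocks.
    remaining (suc w) total = trans
      (law _ (sym total) ((suc w , just a , α) ∷ rest) (s≤s z≤n ∷ Wide-next t fs wide , full (suc w) total))
      (trans (sym (x*[1-0*y] _ _ (indicator-no (a ≟ 0#) a≢0)))
             (cong (γ ∘ suc) (trans (Listₚ.length-map (next t) fs) (sym (Listₚ.length-map fix fs)))))

  law-fixed : ∀ n → (∀ m → n ≡ suc m → ∀ bs → Full n bs → NonsingularityLaw n bs) →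
              ∀ fs → Full (suc n) (List.map fix fs) → NonsingularityLaw (suc n) (List.map fix fs)
  law-fixed n law fs full with pivot fs
  ... | inj₁ zs = trans (singular-zeros zs) (sym (trans (cong (λ z → γ (length (List.map fix fs)) * (1ℚ - z)) (allZero-zeros zs)) (ℚₚ.*-zeroʳ (γ (length (List.map fix fs))))))
  ... | inj₂ (t , fs′ , σ , t≢0 , ds) = law-↭ (Permₚ.map⁺ fix σ) (law-pivot n law t fs′ t≢0 ds (Full-↭ (Permₚ.map⁺ fix σ) full))

  law-move : ∀ {n} bs → (∀ fs → Full n (bs ++ List.map fix fs) → NonsingularityLaw n (bs ++ List.map fix fs)) →
             ∀ v a α fs → Full n ((v , just a , α) ∷ bs ++ List.map fix fs) → NonsingularityLaw n ((v , just a , α) ∷ bs ++ List.map fix fs)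
  law-move {n} bs law v a α fs full = law-↭ {n} σ (law ((v , a , α) ∷ fs) (Full-↭ σ full))
    where σ = ↭-sym (Permₚ.shift (v , just a , α) bs (List.map fix fs))

  -- With u₀ fixed, the law is affine in the indicator of u₀ = 0, so averaging merely replaces that
  -- indicator by 1/q, the value of `headZero` at a random u₀. Blocks already resolved collect in
  -- `fs`, behind the others.
  law-resolve : ∀ n → (∀ fs → Full n (List.map fix fs) → NonsingularityLaw n (List.map fix fs)) →
                ∀ bs fs → Full n (bs ++ List.map fix fs) → NonsingularityLaw n (bs ++ List.map fix fs)
  law-resolve n law []                       fs full = law fs full
  law-resolve n law ((v , just a , α) ∷ bs)  fs full = law-move bs (law-resolve n law bs) v a α fs full
  law-resolve n law ((v , nothing , α) ∷ bs) fs full = begin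
    avg (λ a → draws n ((v , just a , α) ∷ rest) (χ n))
      ≡⟨ avg-cong (λ a → law-move bs (law-resolve n law bs) v a α fs full′) ⟩
    avg (λ a → G * (1ℚ - isZero a * Z))
      ≡⟨ avg-cong (λ a → solve 3 (λ g i z → g :* (con 1ℚ :- i :* z) := g :+ (con 0ℚ :- g :* z) :* i) refl G (isZero a) Z) ⟩
    avg (λ a → G + (0ℚ - G * Z) * isZero a)
      ≡⟨ avg-affine G (0ℚ - G * Z) isZero ⟩
    G + (0ℚ - G * Z) * avg isZero
      ≡⟨ cong (λ i → G + (0ℚ - G * Z) * i) avg-isZero ⟩
    G + (0ℚ - G * Z) * 1/q
      ≡⟨ solve 3 (λ g i z → g :* (con 1ℚ :- i :* z) := g :+ (con 0ℚ :- g :* z) :* i) refl G 1/q Z ⟨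
    G * (1ℚ - 1/q * Z) ∎
    where
    open ≡-Reasoning
    rest = bs ++ List.map fix fs
    G = γ (suc (length rest))
    Z = allZero rest
    full′ : ∀ {a} → Full n ((v , just a , α) ∷ rest)
    full′ = All.head (proj₁ full) ∷ All.tail (proj₁ full) , proj₂ full

  nonsingularity-law : ∀ n bs → Full (suc n) bs → NonsingularityLaw (suc n) bs
  nonsingularity-law n bs full = subst (NonsingularityLaw (suc n)) (Listₚ.++-identityʳ bs)
    (law-resolve (suc n) (law-fixed n λ { m refl → nonsingularity-law m }) bs [] (subst (Full (suc n)) (sym (Listₚ.++-identityʳ bs)) full))

-- Splitting a list along a duplicate-free sublist.

∈⇒↭∷ : ∀ {a} {A : Set a} {x : A} {xs} → x ∈ xs → ∃ λ ys → xs ↭ x ∷ ys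
∈⇒↭∷ {x = x} x∈xs with ys , zs , refl ← ∈ₚ.∈-∃++ x∈xs = ys ++ zs , Permₚ.shift x ys zs

∈-∷⁻ : ∀ {a} {A : Set a} {x y : A} {xs} → y ≢ x → x ∈ y ∷ xs → x ∈ xs
∈-∷⁻ y≢x (here refl)  = contradiction refl y≢x
∈-∷⁻ y≢x (there x∈xs) = x∈xs

-- Separates the indeterminates among the u's, over which the inner average is taken, from the other
-- indeterminates of the matrix.
Unique⊆⇒↭++ : ∀ {a} {A : Set a} {us xs : List A} → Unique us → (∀ {x} → x ∈ us → x ∈ xs) → ∃ λ ws → xs ↭ ws ++ us
Unique⊆⇒↭++ {us = []} {xs} [] us⊆xs = xs , Perm.↭-reflexive (sym (Listₚ.++-identityʳ xs))
Unique⊆⇒↭++ {us = u ∷ us} {xs} (u∉us ∷ uniq) us⊆xs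
  with ys , σ ← ∈⇒↭∷ (us⊆xs (here refl))
  with ws , τ ← Unique⊆⇒↭++ {xs = ys} uniq (λ x∈us → ∈-∷⁻ (All.lookup u∉us x∈us) (Permₚ.∈-resp-↭ σ (us⊆xs (there x∈us))))
  = ws , Perm.trans σ (Perm.trans (Perm.prep u τ) (↭-sym (Permₚ.shift u ws us)))

-- Counting assignments by conditional expectations.

module Conditioning {c} (F : FiniteField c) where
  open import Data.Rational.Base using (_+_; -_)
  open FiniteField F using (Carrier; 0#; q; elements; enumeration)
  open Inverse enumeration using () renaming (to to element)
  open Average F
  open OverField F

  ↦-same : ∀ (ρ : Assignment) x a → (ρ [ x ↦ a ]) x ≡ a
  ↦-same ρ x a = cong (if_then a else ρ x) (dec-true (x ℕₚ.≟ x) refl)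

  ↦-other : ∀ (ρ : Assignment) {x y} a → y ≢ x → (ρ [ x ↦ a ]) y ≡ ρ y
  ↦-other ρ {x} {y} a y≢x = cong (if_then a else ρ y) (dec-false (y ℕₚ.≟ x) y≢x)

  ↦-cong : ∀ (ρ ρ′ : Assignment) x a → ρ ≗ ρ′ → ρ [ x ↦ a ] ≗ ρ′ [ x ↦ a ]
  ↦-cong ρ ρ′ x a ρ≗ρ′ y = cong (if does (y ℕₚ.≟ x) then a else_) (ρ≗ρ′ y)

  ↦-comm : ∀ (ρ : Assignment) {x y} a b → x ≢ y → ρ [ x ↦ a ] [ y ↦ b ] ≗ ρ [ y ↦ b ] [ x ↦ a ]
  ↦-comm ρ {x} {y} a b x≢y z = go (z ℕₚ.≟ x) (z ℕₚ.≟ y)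
    where
    ρ₁ = ρ [ x ↦ a ]
    ρ₂ = ρ [ y ↦ b ]
    go : Dec (z ≡ x) → Dec (z ≡ y) → (ρ₁ [ y ↦ b ]) z ≡ (ρ₂ [ x ↦ a ]) z
    go (yes refl) (yes refl) = contradiction refl x≢y
    go (yes refl) (no  z≢y)  = trans (↦-other ρ₁ b z≢y) (trans (↦-same ρ z a) (sym (↦-same ρ₂ z a)))
    go (no  z≢x)  (yes refl) = trans (↦-same ρ₁ z b) (sym (trans (↦-other ρ₂ a z≢x) (↦-same ρ z b)))
    go (no  z≢x)  (no  z≢y)  = trans (↦-other ρ₁ b z≢y) (trans (↦-other ρ a z≢x) (sym (trans (↦-other ρ₂ a z≢x) (↦-other ρ b z≢y))))

  Respects : (Assignment → ℚ) → Set c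
  Respects f = ∀ ρ ρ′ → ρ ≗ ρ′ → f ρ ≡ f ρ′

  -- The conditional expectation of f given the values under ρ of the indeterminates outside the list.
  cond : List Indet → (Assignment → ℚ) → Assignment → ℚ
  cond []       f ρ = f ρ
  cond (x ∷ xs) f ρ = avg λ a → cond xs f (ρ [ x ↦ a ])

  cond-respects : ∀ xs {f} → Respects f → Respects (cond xs f)
  cond-respects []       resp ρ ρ′ ρ≗ρ′ = resp ρ ρ′ ρ≗ρ′
  cond-respects (x ∷ xs) resp ρ ρ′ ρ≗ρ′ = avg-cong λ a → cond-respects xs resp (ρ [ x ↦ a ]) (ρ′ [ x ↦ a ]) (↦-cong ρ ρ′ x a ρ≗ρ′)

  cond-↭ : ∀ {xs ys f} → Respects f → xs ↭ ys → ∀ ρ → cond xs f ρ ≡ cond ys f ρ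
  cond-↭ resp Perm.refl        ρ = refl
  cond-↭ resp (Perm.prep x σ)  ρ = avg-cong λ a → cond-↭ resp σ (ρ [ x ↦ a ])
  cond-↭ {_ ∷ _ ∷ xs} {_ ∷ _ ∷ ys} {f} resp (Perm.swap x y σ) ρ with x ℕₚ.≟ y
  ... | yes refl = avg-cong λ a → avg-cong λ b → cond-↭ resp σ (ρ [ x ↦ a ] [ y ↦ b ])
  ... | no  x≢y  = trans (avg-comm λ a b → cond xs f (ρ [ x ↦ a ] [ y ↦ b ])) (avg-cong λ b → avg-cong λ a →
    trans (cond-↭ resp σ (ρ [ x ↦ a ] [ y ↦ b ])) (cond-respects ys resp (ρ [ x ↦ a ] [ y ↦ b ]) (ρ [ y ↦ b ] [ x ↦ a ]) (↦-comm ρ a b x≢y)))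
  cond-↭ resp (Perm.trans σ τ) ρ = trans (cond-↭ resp σ ρ) (cond-↭ resp τ ρ)

  AgreeOff : List Indet → Assignment → Assignment → Set c
  AgreeOff xs ρ ρ′ = ∀ y → y ∉ xs → ρ′ y ≡ ρ y

  agreeOff-∷ : ∀ {x xs} ρ a ρ′ → AgreeOff xs (ρ [ x ↦ a ]) ρ′ → AgreeOff (x ∷ xs) ρ ρ′
  agreeOff-∷ ρ a ρ′ agree y y∉ = trans (agree y (y∉ ∘ there)) (↦-other ρ a (y∉ ∘ here))

  cond-agree : ∀ xs {f f′} ρ → (∀ ρ′ → AgreeOff xs ρ ρ′ → f ρ′ ≡ f′ ρ′) → cond xs f ρ ≡ cond xs f′ ρ
  cond-agree []       ρ eq = eq ρ λ _ _ → refl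
  cond-agree (x ∷ xs) ρ eq = avg-cong λ a → cond-agree xs (ρ [ x ↦ a ]) λ ρ′ agree → eq ρ′ (agreeOff-∷ ρ a ρ′ agree)

  cond-const : ∀ xs x ρ → cond xs (λ _ → x) ρ ≡ x
  cond-const []       x ρ = refl
  cond-const (y ∷ ys) x ρ = trans (avg-cong λ a → cond-const ys x (ρ [ y ↦ a ])) (avg-const x)

  avg-complement : ∀ f → avg (λ a → 1ℚ - f a) ≡ 1ℚ - avg f
  avg-complement f = trans (avg-cong λ a → rewrite⁻ (f a)) (trans (avg-affine 1ℚ (- 1ℚ) f) (sym (rewrite⁻ (avg f))))
    where
    rewrite⁻ : ∀ y → 1ℚ - y ≡ 1ℚ + (- 1ℚ) * y
    rewrite⁻ = solve 1 (λ y → con 1ℚ :- y := con 1ℚ :+ con (- 1ℚ) :* y) refl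

  cond-complement : ∀ xs f ρ → cond xs (λ ρ → 1ℚ - f ρ) ρ ≡ 1ℚ - cond xs f ρ
  cond-complement []       f ρ = refl
  cond-complement (x ∷ xs) f ρ = trans (avg-cong λ a → cond-complement xs f (ρ [ x ↦ a ]))
                                       (avg-complement λ a → cond xs f (ρ [ x ↦ a ]))

  cond-++ : ∀ xs ys {f} ρ → cond (xs ++ ys) f ρ ≡ cond xs (cond ys f) ρ
  cond-++ []       ys ρ = refl
  cond-++ (x ∷ xs) ys ρ = avg-cong λ a → cond-++ xs ys (ρ [ x ↦ a ])

  -- `assignments` sets the head of its list last, `cond` sets it first; for an indeterminate
  -- outside the tail the two orders agree.
  cond-↦ : ∀ {x xs f} a → Respects f → All (x ≢_) xs → ∀ ρ → cond xs (λ ρ → f (ρ [ x ↦ a ])) ρ ≡ cond xs f (ρ [ x ↦ a ])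
  cond-↦ a resp []            ρ = refl
  cond-↦ {x} {y ∷ ys} a resp (x≢y ∷ x∉ys) ρ = avg-cong λ b →
    trans (cond-↦ a resp x∉ys (ρ [ y ↦ b ])) (cond-respects ys resp (ρ [ y ↦ b ] [ x ↦ a ]) (ρ [ x ↦ a ] [ y ↦ b ]) (↦-comm ρ b a (x≢y ∘ sym)))

  sum-assignments : ∀ {xs f} → Respects f → Unique xs →
                    (1 /q^ length xs) * sumᴸ (assignments xs) f ≡ cond xs f (λ _ → 0#)
  sum-assignments {[]}     {f} resp []            = trans (ℚₚ.*-identityˡ _) (ℚₚ.+-identityʳ _)
  sum-assignments {x ∷ xs} {f} resp (x∉xs ∷ uniq) = begin
    (1 /q^ suc (length xs)) * sumᴸ (assignments (x ∷ xs)) f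
      ≡⟨ cong₂ _*_ (/q^-suc 1 (length xs)) (trans
           (sumᴸ-cartesianProductWith (λ a ρ → ρ [ x ↦ a ]) elements (assignments xs) f)
           (trans (sumᴸ-map element (allFin q) total) (sumᴸ-tabulate (λ i → i) (total ∘ element)))) ⟩
    1/q * 1/qˡ * ℚΣ.sum (total ∘ element)
      ≡⟨ ℚₚ.*-assoc 1/q 1/qˡ _ ⟩
    1/q * (1/qˡ * ℚΣ.sum (total ∘ element))
      ≡⟨ cong (1/q *_) (ℚΣ.*-distribˡ-sum 1/qˡ (total ∘ element)) ⟩
    avg (λ a → 1/qˡ * total a)
      ≡⟨ avg-cong (λ a → trans (sum-assignments (λ ρ ρ′ ρ≗ρ′ → resp (ρ [ x ↦ a ]) (ρ′ [ x ↦ a ]) (↦-cong ρ ρ′ x a ρ≗ρ′)) uniq) (cond-↦ a resp x∉xs (λ _ → 0#))) ⟩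
    cond (x ∷ xs) f (λ _ → 0#) ∎
    where
    open ≡-Reasoning
    1/qˡ = 1 /q^ length xs
    total : Carrier → ℚ
    total a = sumᴸ (assignments xs) λ ρ → f (ρ [ x ↦ a ])

  /q^-split : ∀ a n → a /q^ n ≡ (1 /q^ n) * (pos a / 1)
  /q^-split a zero    = sym (ℚₚ.*-identityˡ _)
  /q^-split a (suc n) = begin
    a /q^ suc n                        ≡⟨ /q^-suc a n ⟩
    1/q * (a /q^ n)                    ≡⟨ cong (1/q *_) (/q^-split a n) ⟩
    1/q * ((1 /q^ n) * (pos a / 1))      ≡⟨ ℚₚ.*-assoc 1/q (1 /q^ n) (pos a / 1) ⟨
    1/q * (1 /q^ n) * (pos a / 1)      ≡⟨ cong (_* (pos a / 1)) (/q^-suc 1 n) ⟨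
    (1 /q^ suc n) * (pos a / 1)          ∎
    where open ≡-Reasoning

  0/q^ : ∀ n → 0 /q^ n ≡ 0ℚ
  0/q^ n = trans (/q^-split 0 n) (ℚₚ.*-zeroʳ (1 /q^ n))

  proportion : ∀ {p} {P : Pred Assignment p} (P? : Decidable P) {xs} → Respects (indicator ∘ P?) → Unique xs →
               length (filter P? (assignments xs)) /q^ length xs ≡ cond xs (indicator ∘ P?) (λ _ → 0#)
  proportion P? {xs} resp uniq = trans (/q^-split (length (filter P? (assignments xs))) (length xs))
    (trans (cong ((1 /q^ length xs) *_) (length-filter P? (assignments xs))) (sum-assignments resp uniq))

-- Slant blocks as random generators.

open ℕSolver using () renaming (solve to solveℕ; _:=_ to _:=ℕ_; _:+_ to _:+ℕ_; con to conℕ)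

opposite-+ : ∀ {n} (i : Fin n) → toℕ (opposite i) ℕ.+ suc (toℕ i) ≡ n
opposite-+ {n} i = trans (cong (ℕ._+ suc (toℕ i)) (Finₚ.opposite-prop i)) (ℕₚ.m∸n+n≡m (Finₚ.toℕ<n i))

module BlockGenerators {c} (F : FiniteField c) where
  open FiniteField F using (Carrier; 0#; _≟_)
  open OverField F
  open Generators F
  open RandomGenerators F
  open Conditioning F
  open Average F

  shift-≥ : ∀ {k i} g → k ≤ i → shift k g i ≡ g (i ∸ k)
  shift-≥ {zero}          g _         = refl
  shift-≥ {suc k} {suc i} g (s≤s k≤i) = shift-≥ g k≤i

  shift-< : ∀ {k i} g → i < k → shift k g i ≡ 0#
  shift-< {suc k} {zero}  g _         = refl
  shift-< {suc k} {suc i} g (s≤s i<k) = shift-< g i<k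

  extend-cong : ∀ {v} {x y : Vector Carrier v} → x ≗ y → extend x ≗ extend y
  extend-cong {zero}  x≗y i       = refl
  extend-cong {suc v} x≗y zero    = x≗y zero
  extend-cong {suc v} x≗y (suc i) = extend-cong (x≗y ∘ suc) i

  fixedHead : Entry → Maybe Carrier
  fixedHead (indet _) = nothing
  fixedHead (const a) = just a

  headVars : Entry → List Indet
  headVars (indet x) = x ∷ []
  headVars (const _) = []

  -- The first m coefficients of `G` are read off the indeterminates `u`. By injectivity the value
  -- drawn for `u zero` survives the later updates, so substituting for the indeterminates amounts
  -- to drawing coefficients.
  rand-cond : ∀ m (u : Fin m → Indet) → (∀ {i j} → u i ≡ u j → i ≡ j) →
    ∀ (G : Assignment → Seq) {H} → Respects≗ H → ∀ α ρ₀ →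
    (∀ ρ → AgreeOff (List.tabulate u) ρ₀ ρ → (∀ i → G ρ (toℕ i) ≡ ρ (u i)) × (∀ i → m ≤ i → G ρ i ≡ α i)) →
    cond (List.tabulate u) (λ ρ → H (G ρ)) ρ₀ ≡ rand m α H
  rand-cond zero    u inj G resp α ρ₀ spec = resp (G ρ₀) α λ i → proj₂ (spec ρ₀ λ _ _ → refl) i z≤n
  rand-cond (suc m) u inj G {H} resp α ρ₀ spec = avg-cong λ a →
    let ρ₁ = ρ₀ [ u zero ↦ a ]
        spec₁ = λ ρ agree → spec ρ (agreeOff-∷ ρ₀ a ρ agree)
    in trans
      (cond-agree us ρ₁ λ ρ agree → resp (G ρ) (a ∷ˢ tl (G ρ))
        λ { zero    → trans (proj₁ (spec₁ ρ agree) zero) (trans (agree (u zero) u₀∉us) (↦-same ρ₀ (u zero) a))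
          ; (suc i) → refl })
      (rand-cond m (u ∘ suc) (Finₚ.suc-injective ∘ inj) (tl ∘ G) (Respects≗-∷ˢ a resp) (tl α) ρ₁
        λ ρ agree → (λ i → proj₁ (spec₁ ρ agree) (suc i)) , λ i m≤i → proj₂ (spec₁ ρ agree) (suc i) (s≤s m≤i))
    where
    us = List.tabulate (u ∘ suc)
    u₀∉us : u zero ∉ us
    u₀∉us u₀∈ with i , eq ← ∈ₚ.∈-tabulate⁻ u₀∈ with () ← inj eq

  module BlockSeries {n} (B : Block n) where
    open Block B
    open IsSlant isSlant

    last : Fin width
    last = opposite (fromℕ< v≥1)

    1+last : suc (toℕ last) ≡ width
    1+last = trans (ℕₚ.+-comm 1 (toℕ last))
      (trans (cong (λ i → toℕ last ℕ.+ suc i) (sym (Finₚ.toℕ-fromℕ< v≥1))) (opposite-+ (fromℕ< v≥1)))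

    m+width : m ℕ.+ width ≡ n
    m+width = ℕₚ.m∸n+n≡m u≥v

    1+m≤n : suc m ≤ n
    1+m≤n = subst (suc m ≤_) (trans (cong (m ℕ.+_) 1+last) m+width)
      (subst (suc m ≤_) (sym (ℕₚ.+-suc m (toℕ last))) (s≤s (ℕₚ.m≤m+n m (toℕ last))))

    -- The last column read from the bottom: u₀, …, u_m, followed by the attic.
    column : Fin n → Entry
    column e = matrix (opposite e) last

    seriesAt : Assignment → Seq
    seriesAt ρ = extend λ e → evaluate ρ (column e)

    -- With r′ and k′ counted from the bottom right corner, `e` is the height r′ - k′ at which the
    -- diagonal through (r , k) meets the last column.
    toeplitz-index : ∀ (r : Fin n) (k : Fin width) (r′ : Fin n) k′ (e : Fin n) → toℕ r′ ℕ.+ suc (toℕ r) ≡ n → k′ ℕ.+ suc (toℕ k) ≡ width → toℕ (opposite e) ℕ.+ suc (toℕ e) ≡ n →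
                     toℕ e ℕ.+ k′ ≡ toℕ r′ → toℕ r ℕ.+ toℕ last ≡ toℕ (opposite e) ℕ.+ toℕ k
    toeplitz-index r k r′ k′ e rn kv en ek = begin
      toℕ r ℕ.+ toℕ last                ≡⟨ cong (toℕ r ℕ.+_) (ℕₚ.suc-injective (trans 1+last (trans (sym kv) (ℕₚ.+-suc k′ (toℕ k))))) ⟩
      toℕ r ℕ.+ (k′ ℕ.+ toℕ k)          ≡⟨ ℕₚ.+-assoc (toℕ r) k′ (toℕ k) ⟨
      toℕ r ℕ.+ k′ ℕ.+ toℕ k            ≡⟨ cong (ℕ._+ toℕ k) (ℕₚ.+-cancelʳ-≡ (suc (toℕ e)) _ _ (begin
        toℕ r ℕ.+ k′ ℕ.+ suc (toℕ e)      ≡⟨ solveℕ 3 (λ r k e → r :+ℕ k :+ℕ (conℕ 1 :+ℕ e) :=ℕ e :+ℕ k :+ℕ (conℕ 1 :+ℕ r)) refl (toℕ r) k′ (toℕ e) ⟩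
        toℕ e ℕ.+ k′ ℕ.+ suc (toℕ r)      ≡⟨ cong (ℕ._+ suc (toℕ r)) ek ⟩
        toℕ r′ ℕ.+ suc (toℕ r)            ≡⟨ trans rn (sym en) ⟩
        toℕ (opposite e) ℕ.+ suc (toℕ e)  ∎)) ⟩
      toℕ (opposite e) ℕ.+ toℕ k        ∎
      where open ≡-Reasoning

    slab-entry : ∀ ρ r k → evaluate ρ (matrix r k) ≡ slab n width (seriesAt ρ) r k
    slab-entry ρ r k with toℕ (opposite k) ℕₚ.≤? toℕ (opposite r)
    ... | yes k′≤r′ = begin
      evaluate ρ (matrix r k)     ≡⟨ cong (evaluate ρ) (toeplitz r k (opposite e) last
                                       (toeplitz-index r k (opposite r) (toℕ (opposite k)) e (opposite-+ r) (opposite-+ k) (opposite-+ e)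
                                         (trans (cong (ℕ._+ toℕ (opposite k)) (Finₚ.toℕ-fromℕ< e<n)) (ℕₚ.m∸n+n≡m k′≤r′)))) ⟩
      evaluate ρ (column e)       ≡⟨ extend-toℕ (λ e → evaluate ρ (column e)) e ⟨
      seriesAt ρ (toℕ e)          ≡⟨ cong (seriesAt ρ) (Finₚ.toℕ-fromℕ< e<n) ⟩
      seriesAt ρ (toℕ (opposite r) ∸ toℕ (opposite k)) ≡⟨ shift-≥ (seriesAt ρ) k′≤r′ ⟨
      slab n width (seriesAt ρ) r k ∎
      where
      open ≡-Reasoning
      e<n : toℕ (opposite r) ∸ toℕ (opposite k) < n
      e<n = ℕₚ.≤-<-trans (ℕₚ.m∸n≤m _ (toℕ (opposite k))) (Finₚ.toℕ<n (opposite r))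
      e : Fin n
      e = fromℕ< e<n
    -- Since r - k - m = k′ - r′, the case k′ > r′ is exactly the basement, where `shift` has its
    -- zeros.
    ... | no k′≰r′ = trans (cong (evaluate ρ) (basement r k (ℕₚ.≰⇒> λ r≤k+m → ℕₚ.<-irrefl total
        (ℕₚ.+-mono-<-≤ (ℕₚ.≰⇒> k′≰r′) (s≤s r≤k+m))))) (sym (shift-< (seriesAt ρ) (ℕₚ.≰⇒> k′≰r′)))
      where
      total : toℕ (opposite r) ℕ.+ suc (toℕ r) ≡ toℕ (opposite k) ℕ.+ suc (toℕ k ℕ.+ m)
      total = trans (opposite-+ r) (trans (sym m+width) (trans (cong (m ℕ.+_) (sym (opposite-+ k)))
        (solveℕ 3 (λ m k′ k → m :+ℕ (k′ :+ℕ (conℕ 1 :+ℕ k)) :=ℕ k′ :+ℕ (conℕ 1 :+ℕ (k :+ℕ m))) refl m (toℕ (opposite k)) (toℕ k))))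

    column-index : ∀ e → toℕ (opposite e) ℕ.+ suc (toℕ e) ≡ toℕ last ℕ.+ suc m
    column-index e = trans (opposite-+ e) (trans (sym m+width) (trans (cong (m ℕ.+_) (sym 1+last))
      (solveℕ 2 (λ m l → m :+ℕ (conℕ 1 :+ℕ l) :=ℕ l :+ℕ (conℕ 1 :+ℕ m)) refl m (toℕ last))))

    column-diag : ∀ s → column (inject≤ s 1+m≤n) ≡ diag s
    column-diag s = diag-entries (opposite e) last s (ℕₚ.suc-injective (begin
      suc (toℕ (opposite e) ℕ.+ toℕ s)   ≡⟨ ℕₚ.+-suc (toℕ (opposite e)) (toℕ s) ⟨
      toℕ (opposite e) ℕ.+ suc (toℕ s)   ≡⟨ cong (λ i → toℕ (opposite e) ℕ.+ suc i) (Finₚ.toℕ-inject≤ s 1+m≤n) ⟨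
      toℕ (opposite e) ℕ.+ suc (toℕ e)   ≡⟨ column-index e ⟩
      toℕ last ℕ.+ suc m                 ≡⟨ ℕₚ.+-suc (toℕ last) m ⟩
      suc (toℕ last ℕ.+ m)               ∎))
      where
      open ≡-Reasoning
      e = inject≤ s 1+m≤n

    column-attic : ∀ e → m < toℕ e → toℕ (opposite e) < toℕ last
    column-attic e m<e = ℕₚ.≰⇒> λ last≤ → ℕₚ.<-irrefl (sym (column-index e)) (ℕₚ.+-mono-≤-< last≤ (s≤s m<e))

    diagVar : Fin m → Indet
    diagVar s = proj₁ (diag-indet s)

    diagVar-injective : ∀ {i j} → diagVar i ≡ diagVar j → i ≡ j
    diagVar-injective {i} {j} eq = Finₚ.suc-injective (diag-distinct
      (trans (proj₂ (diag-indet i)) (trans (cong indet eq) (sym (proj₂ (diag-indet j))))))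

    -- Just the indeterminates among u₀, ..., u_m: those of the attic may repeat on several
    -- diagonals and are held fixed by conditioning. The head comes first, as in `draw`.
    vars : List Indet
    vars = headVars (diag zero) ++ List.tabulate diagVar

    headVars⁻ : ∀ {x} d → x ∈ headVars d → d ≡ indet x
    headVars⁻ (indet _) (here refl) = refl

    vars⁻ : ∀ {x} → x ∈ vars → ∃ λ s → diag s ≡ indet x
    vars⁻ x∈ with ∈ₚ.∈-++⁻ (headVars (diag zero)) x∈
    ... | inj₁ x∈h = zero , headVars⁻ (diag zero) x∈h
    ... | inj₂ x∈t with s , refl ← ∈ₚ.∈-tabulate⁻ x∈t = suc s , proj₂ (diag-indet s)

    vars-occur : ∀ {x} → x ∈ vars → x OccursIn matrix
    vars-occur x∈ with s , eq ← vars⁻ x∈ = opposite (inject≤ s 1+m≤n) , last , trans (column-diag s) eq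

    head∉diagVars : ∀ {x} → diag zero ≡ indet x → x ∉ List.tabulate diagVar
    head∉diagVars eq x∈ with s , refl ← ∈ₚ.∈-tabulate⁻ x∈
      with () ← diag-distinct (trans eq (sym (proj₂ (diag-indet s))))

    vars-unique : Unique vars
    vars-unique = Uniqueₚ.++⁺ (head-unique (diag zero)) (Uniqueₚ.tabulate⁺ diagVar-injective)
      λ (x∈h , x∈t) → head∉diagVars (headVars⁻ (diag zero) x∈h) x∈t
      where
      head-unique : ∀ d → Unique (headVars d)
      head-unique (indet x) = [] ∷ []
      head-unique (const a) = []

    -- `σ` supplies the attic values; by `attic-distinct` no attic indeterminate lies in `vars`.
    AgreeOnAttic : Assignment → Assignment → Set c
    AgreeOnAttic σ ρ = ∀ x → x OccursIn matrix → x ∉ vars → ρ x ≡ σ x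

    seriesAt-agree : ∀ ρ σ → (∀ x → x OccursIn matrix → ρ x ≡ σ x) → seriesAt ρ ≗ seriesAt σ
    seriesAt-agree ρ σ agree = extend-cong λ e → entry (column e) (λ x eq → agree x (opposite e , last , eq))
      where
      entry : ∀ d → (∀ x → d ≡ indet x → ρ x ≡ σ x) → evaluate ρ d ≡ evaluate σ d
      entry (indet x) agree = agree x refl
      entry (const a) agree = refl

    seriesAt-diag : ∀ ρ s → seriesAt ρ (toℕ s) ≡ evaluate ρ (diag s)
    seriesAt-diag ρ s = trans (cong (seriesAt ρ) (sym (Finₚ.toℕ-inject≤ s 1+m≤n)))
      (trans (extend-toℕ (λ e → evaluate ρ (column e)) (inject≤ s 1+m≤n)) (cong (evaluate ρ) (column-diag s)))

    seriesAt-attic : ∀ ρ σ → AgreeOnAttic σ ρ → ∀ i → m < i → seriesAt ρ i ≡ seriesAt σ i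
    seriesAt-attic ρ σ agree i m<i with i ℕₚ.<? n
    ... | no  i≮n = trans (extend-≥ _ i (ℕₚ.≮⇒≥ i≮n)) (sym (extend-≥ _ i (ℕₚ.≮⇒≥ i≮n)))
    ... | yes i<n = begin
      seriesAt ρ i           ≡⟨ cong (seriesAt ρ) toℕ-e ⟨
      seriesAt ρ (toℕ e)     ≡⟨ extend-toℕ (λ e → evaluate ρ (column e)) e ⟩
      evaluate ρ (column e)  ≡⟨ entry (column e) refl ⟩
      evaluate σ (column e)  ≡⟨ extend-toℕ (λ e → evaluate σ (column e)) e ⟨
      seriesAt σ (toℕ e)     ≡⟨ cong (seriesAt σ) toℕ-e ⟩
      seriesAt σ i           ∎
      where
      open ≡-Reasoning
      e = fromℕ< i<n
      toℕ-e : toℕ e ≡ i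
      toℕ-e = Finₚ.toℕ-fromℕ< i<n
      entry : ∀ d → column e ≡ d → evaluate ρ d ≡ evaluate σ d
      entry (const a) eq = refl
      entry (indet x) eq = agree x (opposite e , last , eq) λ x∈ →
        let s , eq′ = vars⁻ x∈ in
        attic-distinct (opposite e) last (column-attic e (subst (m <_) (sym toℕ-e) m<i)) x eq s eq′

    generator : Assignment → Generator
    generator ρ = width , seriesAt ρ

    -- The first `m` coefficients of the base are the values of u₁, ..., u_m under `σ`, which `rand`
    -- replaces; what survives is the attic.
    spec : Assignment → Spec
    spec σ = width , fixedHead (diag zero) , tl (seriesAt σ)

    module _ {H : Generator → ℚ} (resp : ∀ v → Respects≗ (λ s → H (v , s))) (σ : Assignment) where

      draw-tail : ∀ a ρ₁ → (∀ ρ → AgreeOff (List.tabulate diagVar) ρ₁ ρ → evaluate ρ (diag zero) ≡ a) → AgreeOnAttic σ ρ₁ →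
                  cond (List.tabulate diagVar) (λ ρ → H (generator ρ)) ρ₁ ≡ rand m (tl (seriesAt σ)) λ s → H (width , a ∷ˢ s)
      draw-tail a ρ₁ head-a attic = trans
        (cond-agree (List.tabulate diagVar) ρ₁ λ ρ agree → resp width (seriesAt ρ) (a ∷ˢ tl (seriesAt ρ))
          λ { zero → trans (seriesAt-diag ρ zero) (head-a ρ agree) ; (suc i) → refl })
        (rand-cond m diagVar diagVar-injective (tl ∘ seriesAt) (Respects≗-∷ˢ a (resp width)) (tl (seriesAt σ)) ρ₁ λ ρ agree →
          (λ i → trans (seriesAt-diag ρ (suc i)) (cong (evaluate ρ) (proj₂ (diag-indet i)))) ,
          λ i m≤i → seriesAt-attic ρ σ (λ x occ x∉ → trans (agree x (x∉ ∘ ∈ₚ.∈-++⁺ʳ _)) (attic x occ x∉)) (suc i) (s≤s m≤i))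

      cond-draw : ∀ ρ₀ → AgreeOnAttic σ ρ₀ → cond vars (λ ρ → H (generator ρ)) ρ₀ ≡ draw n (spec σ) H
      cond-draw ρ₀ attic = go (diag zero) refl
        where
        go : ∀ d → diag zero ≡ d → cond (headVars d ++ List.tabulate diagVar) (λ ρ → H (generator ρ)) ρ₀ ≡
                                   draw n (width , fixedHead d , tl (seriesAt σ)) H
        go (const a) eq = draw-tail a ρ₀ (λ ρ _ → cong (evaluate ρ) eq) attic
        go (indet x) eq = avg-cong λ a → draw-tail a (ρ₀ [ x ↦ a ])
          (λ ρ agree → trans (cong (evaluate ρ) eq) (trans (agree x (head∉diagVars eq)) (↦-same ρ₀ x a)))
          (λ y occ y∉ → trans (↦-other ρ₀ a λ { refl → y∉ (∈ₚ.∈-++⁺ˡ (subst (λ d → y ∈ headVars d) (sym eq) (here refl))) }) (attic y occ y∉))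

  occurs⇒∈indeterminates : ∀ {u v x} (A : Matrix Entry u v) → x OccursIn A → x ∈ indeterminates A
  occurs⇒∈indeterminates A (r , k , eq) = ∈ₚ.∈-deduplicate⁺ ℕₚ._≟_ (∈-mapMaybe
    (∈ₚ.∈-cartesianProductWith⁺ A (∈ₚ.∈-allFin r) (∈ₚ.∈-allFin k)) (cong indet? eq))
    where
    ∈-mapMaybe : ∀ {e x es} → e ∈ es → indet? e ≡ just x → x ∈ mapMaybe indet? es
    ∈-mapMaybe {e} (here refl) eq with indet? e | eq
    ... | just _ | refl = here refl
    ∈-mapMaybe {es = d ∷ _} (there e∈) eq with indet? d
    ... | just _  = there (∈-mapMaybe e∈ eq)
    ... | nothing = ∈-mapMaybe e∈ eq

  -- Assembling the blocks of a multislant matrix.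

  module _ {n : ℕ} where
    open BlockSeries {n} using (vars; vars-occur; vars-unique; AgreeOnAttic; spec; generator; slab-entry; cond-draw; seriesAt; seriesAt-agree)

    generators : Assignment → List (Block n) → List Generator
    generators ρ = List.map λ B → generator B ρ

    specs : Assignment → List (Block n) → List Spec
    specs σ = List.map λ B → spec B σ

    allVars : List (Block n) → List Indet
    allVars []       = []
    allVars (B ∷ Bs) = vars B ++ allVars Bs

    DisjointBlocks : Block n → Block n → Set c
    DisjointBlocks B C = Disjoint (Block.matrix B) (Block.matrix C)

    allVars-occur : ∀ {x} Bs → x ∈ allVars Bs → ∃ λ B → B ∈ Bs × x OccursIn Block.matrix B
    allVars-occur (B ∷ Bs) x∈ with ∈ₚ.∈-++⁻ (vars B) x∈
    ... | inj₁ x∈B = B , here refl , vars-occur B x∈B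
    ... | inj₂ x∈Bs with C , C∈ , occ ← allVars-occur Bs x∈Bs = C , there C∈ , occ

    occurs⇒∉allVars : ∀ {x} B Bs → All (DisjointBlocks B) Bs → x OccursIn Block.matrix B → x ∉ allVars Bs
    occurs⇒∉allVars B Bs disj occ x∈ with C , C∈ , occ′ ← allVars-occur Bs x∈ = All.lookup disj C∈ _ (occ , occ′)

    allVars-unique : ∀ {Bs} → AllPairs DisjointBlocks Bs → Unique (allVars Bs)
    allVars-unique {[]}     []           = []
    allVars-unique {B ∷ Bs} (disj ∷ disjs) = Uniqueₚ.++⁺ (vars-unique B) (allVars-unique disjs)
      λ (x∈B , x∈Bs) → occurs⇒∉allVars B Bs disj (vars-occur B x∈B) x∈Bs

    -- By disjointness, substituting for the `vars` of later blocks leaves the series of `B` as it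
    -- was, and substituting for those of `B` leaves the attics of the later blocks as they were. So
    -- the blocks can be drawn one after another.
    cond-draws : ∀ Bs → AllPairs DisjointBlocks Bs → ∀ σ ρ₀ {f} → Respects≈ᵍ f → All (λ B → AgreeOnAttic B σ ρ₀) Bs →
                 cond (allVars Bs) (λ ρ → f (generators ρ Bs)) ρ₀ ≡ draws n (specs σ Bs) f
    cond-draws []       []             σ ρ₀ resp []                = refl
    cond-draws (B ∷ Bs) (disj ∷ disjs) σ ρ₀ {f} resp (attic ∷ attics) = begin
      cond (vars B ++ allVars Bs) (λ ρ → f (generators ρ (B ∷ Bs))) ρ₀
        ≡⟨ cond-++ (vars B) (allVars Bs) ρ₀ ⟩
      cond (vars B) (cond (allVars Bs) (λ ρ → f (generators ρ (B ∷ Bs)))) ρ₀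
        ≡⟨ cond-agree (vars B) ρ₀ (λ ρ₁ agree → trans
             (cond-agree (allVars Bs) ρ₁ λ ρ agree′ → resp ((refl , seriesAt-agree B ρ ρ₁ λ x occ → agree′ x (occurs⇒∉allVars B Bs disj occ)) ∷ ≈ᵍ-refl))
             (cond-draws Bs disjs σ ρ₁ (λ eqs → resp ((refl , λ _ → refl) ∷ eqs)) (attics′ ρ₁ agree))) ⟩
      cond (vars B) (λ ρ → H (generator B ρ)) ρ₀
        ≡⟨ cond-draw B {H} (λ v s s′ s≗s′ → draws-cong n (specs σ Bs) λ gs → resp ((refl , s≗s′) ∷ ≈ᵍ-refl)) σ ρ₀ attic ⟩
      draws n (specs σ (B ∷ Bs)) f ∎
      where
      open ≡-Reasoning
      H : Generator → ℚ
      H g = draws n (specs σ Bs) λ gs → f (g ∷ gs)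
      attics′ : ∀ ρ₁ → AgreeOff (vars B) ρ₀ ρ₁ → All (λ C → AgreeOnAttic C σ ρ₁) Bs
      attics′ ρ₁ agree = All.zipWith (λ (dj , attic) x occ x∉ → trans (agree x λ x∈B → dj x (vars-occur B x∈B , occ)) (attic x occ x∉)) (disj , attics)

    slabs-entry : ∀ ρ Bs r k → evaluate ρ (juxtapose Bs r k) ≡ Slabs.slabs (λ B → generator B ρ) n Bs r k
    slabs-entry ρ (B ∷ Bs) r k with splitAt (Block.width B) k
    ... | inj₁ i = slab-entry B ρ r i
    ... | inj₂ j = slabs-entry ρ Bs r j

    totalSize-generators : ∀ ρ Bs → totalSize (generators ρ Bs) ≡ totalWidth Bs
    totalSize-generators ρ Bs = cong ListAction.sum (sym (Listₚ.map-∘ Bs))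

    size-specs : ∀ σ Bs → size (specs σ Bs) ≡ totalWidth Bs
    size-specs σ Bs = cong ListAction.sum (sym (Listₚ.map-∘ Bs))

    Wide-specs : ∀ σ Bs → All Wide (specs σ Bs)
    Wide-specs σ []       = []
    Wide-specs σ (B ∷ Bs) = IsSlant.v≥1 (Block.isSlant B) ∷ Wide-specs σ Bs

    typeZero : BlockType → ℚ
    typeZero typeX = 1/q
    typeZero type0 = 1ℚ
    typeZero type1 = 0ℚ

    headZero-spec : ∀ σ B → headZero (spec B σ) ≡ typeZero (Block.blockType B)
    headZero-spec σ B with IsSlant.diag (Block.isSlant B) zero
    ... | indet x = refl
    ... | const a with does (a ≟ 0#)
    ...   | true  = refl
    ...   | false = refl

    allZero-specs : ∀ σ Bs → let i , j , ℓ = tally (List.map Block.blockType Bs) in allZero (specs σ Bs) ≡ (0 ^ ℓ) /q^ i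
    allZero-specs σ []       = refl
    allZero-specs σ (B ∷ Bs) = trans (cong₂ _*_ (headZero-spec σ B) (allZero-specs σ Bs)) (prepend (Block.blockType B) _)
      where
      prepend : ∀ t ts → let i , j , ℓ = tally ts ; i′ , j′ , ℓ′ = tally (t ∷ ts) in typeZero t * ((0 ^ ℓ) /q^ i) ≡ (0 ^ ℓ′) /q^ i′
      prepend typeX ts = let i , j , ℓ = tally ts in sym (/q^-suc (0 ^ ℓ) i)
      prepend type0 ts = ℚₚ.*-identityˡ _
      prepend type1 ts = let i , j , ℓ = tally ts in trans (ℚₚ.*-zeroˡ ((0 ^ ℓ) /q^ i)) (sym (0/q^ i))

    length-specs : ∀ σ Bs → let i , j , ℓ = tally (List.map Block.blockType Bs) in length (specs σ Bs) ≡ i ℕ.+ j ℕ.+ ℓ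
    length-specs σ []       = refl
    length-specs σ (B ∷ Bs) = trans (cong suc (length-specs σ Bs)) (prepend (Block.blockType B) _)
      where
      prepend : ∀ t ts → let i , j , ℓ = tally ts ; i′ , j′ , ℓ′ = tally (t ∷ ts) in suc (i ℕ.+ j ℕ.+ ℓ) ≡ i′ ℕ.+ j′ ℕ.+ ℓ′
      prepend typeX ts = refl
      prepend type0 ts = let i , j , ℓ = tally ts in cong (ℕ._+ ℓ) (sym (ℕₚ.+-suc i j))
      prepend type1 ts = let i , j , ℓ = tally ts in sym (ℕₚ.+-suc (i ℕ.+ j) ℓ)

    occurs-juxtapose : ∀ {x} {B : Block n} {Bs} → B ∈ Bs → x OccursIn Block.matrix B → x OccursIn juxtapose Bs
    occurs-juxtapose {B = B} {_ ∷ Bs} (here refl) (r , k , eq) =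
      r , k ↑ˡ totalWidth Bs , trans (++-↑ˡ (Block.matrix B r) (juxtapose Bs r) k) eq
    occurs-juxtapose {Bs = C ∷ Bs} (there B∈) occ with r , k , eq ← occurs-juxtapose B∈ occ =
      r , Block.width C ↑ʳ k , trans (++-↑ʳ (Block.matrix C r) (juxtapose Bs r) k) eq

-- The singular probability of a multislant matrix.

module SingularProbability {c} (F : FiniteField c) {n} (M : OverField.Multislant F n) (sq : OverField.IsSquare F M) where
  open FiniteField F using (Carrier; 0#; _≟_)
  open OverField F
  open Multislant M using (blocks; pairwiseDisjoint)
  open LinearAlgebra F
  open Generators F
  open RandomGenerators F
  open Conditioning F
  open BlockGenerators F

  determinant : Assignment → Carrier
  determinant ρ = det (substitute ρ (squareMatrix M sq))

  singular? : ∀ ρ → Dec (determinant ρ ≡ 0#)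
  singular? ρ = determinant ρ ≟ 0#

  determinant-cong : ∀ ρ ρ′ → ρ ≗ ρ′ → determinant ρ ≡ determinant ρ′
  determinant-cong ρ ρ′ ρ≗ρ′ = det-cong λ r k → entry (squareMatrix M sq r k)
    where
    entry : ∀ e → evaluate ρ e ≡ evaluate ρ′ e
    entry (indet x) = ρ≗ρ′ x
    entry (const a) = refl

  nonsingular⇔ : ∀ ρ → Nonsingular n (generators ρ blocks) ⇔ determinant ρ ≢ 0#
  nonsingular⇔ ρ = mk⇔
    (λ (_ , ind) → TrivialKernel⇒det≢0 _ (Equivalence.from cast⇔ (TrivialKernel-cong slabs juxtaposed (λ r k → sym (slabs-entry ρ blocks r k))
      (Equivalence.to independent⇔ ind))))
    (λ det≢0 → trans (totalSize-generators ρ blocks) sq , Equivalence.from independent⇔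
      (TrivialKernel-cong juxtaposed slabs (slabs-entry ρ blocks) (Equivalence.to cast⇔ (det≢0⇒TrivialKernel _ det≢0))))
    where
    juxtaposed : Matrix Carrier n (totalWidth blocks)
    juxtaposed = substitute ρ (juxtapose blocks)
    slabs : Matrix Carrier n (totalWidth blocks)
    slabs = Slabs.slabs (λ B → BlockSeries.generator B ρ) n blocks
    cast⇔ = TrivialKernel-cast sq juxtaposed
    independent⇔ = Slabs.Independent⇔TrivialKernel (λ B → BlockSeries.generator B ρ) {n} blocks

  singular≡1-χ : ∀ ρ → indicator (singular? ρ) ≡ 1ℚ - χ n (generators ρ blocks)
  singular≡1-χ ρ = go (singular? ρ)
    where
    gs = generators ρ blocks
    go : Dec (determinant ρ ≡ 0#) → indicator (singular? ρ) ≡ 1ℚ - χ n gs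
    go (yes det≡0) = trans (indicator-yes (singular? ρ) det≡0)
      (cong (λ z → 1ℚ - z) (sym (χ-no n gs λ ns → Equivalence.to (nonsingular⇔ ρ) ns det≡0)))
    go (no  det≢0) = trans (indicator-no (singular? ρ) det≢0)
      (cong (λ z → 1ℚ - z) (sym (χ-yes n gs (Equivalence.from (nonsingular⇔ ρ) det≢0))))

  -- Given the indeterminates outside `allVars`, the conditional probability of nonsingularity does
  -- not depend on their values, so the average over `ws` is that of a constant. `σ` is arbitrary
  -- because the length and `allZero` of the specs are the same for all assignments.
  SiPr-formula : n ≢ 0 → ∀ σ → SiPr M sq ≡ 1ℚ - γ (length (specs σ blocks)) * (1ℚ - allZero (specs σ blocks))
  SiPr-formula n≢0 σ = begin
    SiPr M sq
      ≡⟨ proportion singular? {xs} (λ ρ ρ′ ρ≗ρ′ → cong (λ a → indicator (a ≟ 0#)) (determinant-cong ρ ρ′ ρ≗ρ′))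
           (UniqueDecₚ.deduplicate-! ℕₚ._≟_ (mapMaybe indet? (cartesianProductWith (squareMatrix M sq) (allFin _) (allFin _)))) ⟩
    cond xs (indicator ∘ singular?) ρ₀
      ≡⟨ cond-agree xs ρ₀ (λ ρ _ → singular≡1-χ ρ) ⟩
    cond xs (λ ρ → 1ℚ - χᴹ ρ) ρ₀
      ≡⟨ cond-complement xs χᴹ ρ₀ ⟩
    1ℚ - cond xs χᴹ ρ₀
      ≡⟨ cong (λ z → 1ℚ - z) (trans (cond-↭ χᴹ-respects (proj₂ split) ρ₀) (cond-++ ws (allVars blocks) ρ₀)) ⟩
    1ℚ - cond ws (cond (allVars blocks) χᴹ) ρ₀
      ≡⟨ cong (λ z → 1ℚ - z) (trans (cond-agree ws ρ₀ λ ρ _ → law ρ) (cond-const ws _ ρ₀)) ⟩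
    1ℚ - γ (length (specs σ blocks)) * (1ℚ - allZero (specs σ blocks)) ∎
    where
    open ≡-Reasoning
    ρ₀ : Assignment
    ρ₀ _ = 0#
    xs = indeterminates (squareMatrix M sq)
    χᴹ : Assignment → ℚ
    χᴹ ρ = χ n (generators ρ blocks)
    occurs⇒∈xs : ∀ {x} → x OccursIn juxtapose blocks → x ∈ xs
    occurs⇒∈xs (r , k , eq) = occurs⇒∈indeterminates (squareMatrix M sq)
      (r , cast sq k , trans (cong (juxtapose blocks r) (trans (Finₚ.cast-trans sq (sym sq) k) (Finₚ.cast-is-id refl k))) eq)
    allVars⊆xs : ∀ {x} → x ∈ allVars blocks → x ∈ xs
    allVars⊆xs x∈ = let B , B∈ , occ = allVars-occur blocks x∈ in occurs⇒∈xs (occurs-juxtapose B∈ occ)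
    split = Unique⊆⇒↭++ (allVars-unique pairwiseDisjoint) allVars⊆xs
    ws = proj₁ split
    χᴹ-respects : Respects χᴹ
    χᴹ-respects ρ ρ′ ρ≗ρ′ = χ-respects n (agree blocks)
      where
      agree : ∀ Bs → Pointwise _≈ᵍ_ (generators ρ Bs) (generators ρ′ Bs)
      agree []       = []
      agree (B ∷ Bs) = (refl , BlockSeries.seriesAt-agree B ρ ρ′ λ x _ → ρ≗ρ′ x) ∷ agree Bs
    -- `n` and the blocks are quantified afresh so that `n` can be split; the outer `n` is tied to
    -- the type of `M`.
    specs-law : ∀ n (Bs : List (Block n)) ρ → n ≢ 0 → totalWidth Bs ≡ n → NonsingularityLaw n (specs ρ Bs)
    specs-law zero    Bs ρ n≢0 sq = contradiction refl n≢0
    specs-law (suc n) Bs ρ n≢0 sq = nonsingularity-law n (specs ρ Bs) (Wide-specs ρ Bs , trans (size-specs ρ Bs) sq)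
    law : ∀ ρ → cond (allVars blocks) χᴹ ρ ≡ γ (length (specs σ blocks)) * (1ℚ - allZero (specs σ blocks))
    -- The assignment `ρ` conditioned on supplies the attic values itself, so the agreement is
    -- reflexivity.
    law ρ = trans (cond-draws blocks pairwiseDisjoint ρ ρ (χ-respects n) (All.tabulate λ _ _ _ _ → refl))
      (trans (specs-law n blocks ρ n≢0 sq)
        (cong₂ (λ k z → γ k * (1ℚ - z)) (trans (length-specs ρ blocks) (sym (length-specs σ blocks)))
                                        (trans (allZero-specs ρ blocks) (sym (allZero-specs σ blocks)))))

open import Data.Nat.Base using (_+_)

theorem3p12 : ∀ {c} (F : FiniteField c) → let open OverField F in
    (n : ℕ) → n ≢ 0 → (M : Multislant n) (sq : IsSquare M) →
    let (i , j , ℓ) = Multislant.signature M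
        k = i + j + ℓ
    in SiPr M sq ≡ 1ℚ - γ k * (1ℚ - (0 ^ ℓ) /q^ i)
theorem3p12 F n n≢0 M sq = trans (SiPr-formula n≢0 σ)
  (cong₂ (λ k z → 1ℚ - γ k * (1ℚ - z)) (length-specs σ blocks) (allZero-specs σ blocks))
  where
  open FiniteField F using (0#)
  open OverField F
  open Multislant M using (blocks)
  open SingularProbability F M sq
  open BlockGenerators F
  σ : Assignment
  σ _ = 0#
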